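{- Let $d>2$ be an integer and let $H=\langle h\rangle$ be a subgroup of order $2$ of $(\mathbb{Z}/d\mathbb{Z})^\times$. Then $H$ is balanced if and only if $d$ and $h$ satisfy one of the following: (1) $h\equiv -1\pmod d$; (2) $d\equiv 0\pmod 4$ and $h\equiv \frac12 d+1\pmod d$; (3) $d=24$ and $h\equiv 17$ or $h\equiv 19\pmod{d}$; (4) $d=60$ and $h\equiv 41$ or $h\equiv 49\pmod d$.
   Context: For an integer $d>2$, let $A_d\subset(\mathbb{Z}/d\mathbb{Z})^\times$ be the set of residues having a representative in $(0,d/2)$ and $B_d=(\mathbb{Z}/d\mathbb{Z})^\times\setminus A_d$. A subgroup $H$ of $(\mathbb{Z}/d\mathbb{Z})^\times$ is called balanced if for every $u\in(\mathbb{Z}/d\mathbb{Z})^\times$ we have $|uH\cap A_d|=|uH\cap B_d|$. -}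

module Defs where

open import Data.Nat using (ℕ; _<_; _*_; _^_; _%_; _<ᵇ_; _≡ᵇ_; _+_; suc)
open import Data.Nat.GCD using (gcd)
open import Data.Bool using (Bool; true; _∧_; not)
open import Relation.Binary.PropositionalEquality using (_≡_)
open import Data.List using (List; upTo; filterᵇ; length)
open import Data.Bool.ListAction using (any)

-- Residues mod d are represented by their canonical representatives 0,…,d-1.

-- canonical representative of x mod d (d = 0 never arises: d > 2 throughout)
_mod_ : ℕ → ℕ → ℕ
x mod 0 = x
x mod (suc n) = x % suc n

isUnit : ℕ → ℕ → Bool
isUnit d x = gcd x d ≡ᵇ 1

units : ℕ → List ℕ
units d = filterᵇ (isUnit d) (upTo d)

inA : ℕ → ℕ → Bool
inA d x = isUnit d x ∧ (0 <ᵇ x) ∧ ((2 * x) <ᵇ d)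

inB : ℕ → ℕ → Bool
inB d x = isUnit d x ∧ not (inA d x)

-- membership in the coset u⟨h⟩ : x ≡ u h^k (mod d) for some k.
-- Ranging k over 0 … d-1 suffices since the order of h divides φ(d) < d.
inCoset : ℕ → ℕ → ℕ → ℕ → Bool
inCoset d h u x = any (λ k → x ≡ᵇ ((u * h ^ k) mod d)) (upTo d)

coset : (d h u : ℕ) → List ℕ
coset d h u = filterᵇ (inCoset d h u) (upTo d)

Balanced : ℕ → ℕ → Set
Balanced d h = ∀ u → u < d → isUnit d u ≡ true →
  length (filterᵇ (inA d) (coset d h u)) ≡ length (filterᵇ (inB d) (coset d h u))

{-# OPTIONS --safe #-}
-- Multiplication by h swaps the two halves of the residues prime to d exactly when multiplication
-- by g = d - h preserves them. In binary, the residues 2^j g run through the digits of g / d; if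
-- all the units 2^j (d odd), m + 2^j (d = 2m, m odd) or n + 2^j (d = 4n, n odd) keep their halves,
-- those digits are forced, and g is one of 1 and 2n - 1 or, when g ≡ 3 mod 4, within 1 of 2n/3 up
-- to g ↦ 2n - g, in which case a single unit excludes all but n = 15. For d = 8k with g ≡ 1 mod 4
-- the unit 1 + 2k shows that g preserves the halves modulo 4k too, which reduces to n odd; the
-- residue 2n - 1 lifts back only from n = 3, to g = 5 modulo 24.
module Submission where

open import Defs
open import Data.Nat
open import Data.Nat.Properties
open import Data.Nat.DivMod using ([m+kn]%n≡m%n; m<n⇒m%n≡m; m*n/n≡m; m≡m%n+[m/n]*n; m%n<n; m<n*o⇒m/o<n; /-monoˡ-≤)
open import Data.Nat.Divisibility
open import Data.Nat.Coprimality using (Coprime; 1-coprimeTo; coprime-divisor; coprime⇒gcd≡1; gcd≡1⇒coprime)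
  renaming (sym to coprime-sym)
open import Data.Nat.Induction using (<-rec)
open import Data.Nat.Tactic.RingSolver using (solve)
open import Data.Bool using (Bool; true; false; _∧_; _∨_; _xor_; not; T)
open import Data.Bool.Properties using (not-involutive; xor-same; T-≡; T-∨; T?) renaming (_≟_ to _≟ᵇ_)
open import Data.Empty using (⊥; ⊥-elim)
open import Data.List using ([]; _∷_; _++_; upTo; filterᵇ; length)
open import Data.List.Properties using (filter-++; upTo-∷ʳ; length-++)
open import Data.List.Relation.Unary.Any.Properties using (any⁺; any⁻; applyUpTo⁺; applyUpTo⁻)
open import Data.Product using (_×_; _,_; ∃; ∃₂; proj₁; proj₂)
open import Data.Sum using (_⊎_; inj₁; inj₂)
open import Function using (_∘_)
open import Function.Bundles using (_⇔_; mk⇔; Equivalence)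
open import Relation.Binary.Definitions using (tri<; tri≈; tri>)
open import Relation.Binary.PropositionalEquality
open import Relation.Nullary using (¬_; Dec; yes; no; contradiction)
open import Relation.Nullary.Decidable using (dec-true; dec-false; does; from-yes; _→-dec_)

-- Where 2n/3 comes from: for d = 4n with n odd, gn is n or 3n modulo 4n according as g is 1 or 3
-- mod 4. The unit t + n with t = 2^j < n is low. That its multiple by g is low too says that gt/4n
-- modulo 1 lies outside [1/4, 3/4) in the first case and inside it in the second. So consecutive
-- binary digits of g/4n are equal, respectively different, from the second digit on; for g < n the
-- second pattern is 0.0010101... = 1/6. The comparison lasts only while t < n, which leaves a
-- bounded error in g. The congruence g² ≡ 1 then rules out one side of 2n/3 and fixes a residue
-- modulo 3 on the other.
--
-- The parity of n matters through the reflection g ↦ 2n - g: it keeps g mod 4 when n is odd and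
-- exchanges 1 and 3 when n is even. Hence the descent on even n is needed for g ≡ 1 mod 4 alone,
-- while the analysis near 2n/3 belongs to odd n. Preservation modulo 4k is weaker than modulo 8k,
-- so on the way back up both lifts of every residue are tested again.

-- a ≤ b as the sum of x ≤ y and the slack k, which leaves a ring identity to check.
by-linear : ∀ {a b x y} k → x ≤ y → a + k + y ≡ x + b → a ≤ b
by-linear {a} {b} {x} {y} k x≤y eq = +-cancelʳ-≤ x a b (begin
  a + x        ≤⟨ +-monoʳ-≤ a x≤y ⟩
  a + y        ≤⟨ +-monoˡ-≤ y (m≤m+n a k) ⟩
  a + k + y    ≡⟨ eq ⟩
  x + b        ≡⟨ +-comm x b ⟩
  b + x        ∎)
  where open ≤-Reasoning

-- Parity.

odd : ℕ → Bool
odd zero    = false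
odd (suc n) = not (odd n)

odd-+ : ∀ m n → odd (m + n) ≡ odd m xor odd n
odd-+ zero    n = refl
odd-+ (suc m) n rewrite odd-+ m n with odd m | odd n
... | true  | true  = refl
... | true  | false = refl
... | false | true  = refl
... | false | false = refl

odd-* : ∀ m n → odd (m * n) ≡ odd m ∧ odd n
odd-* zero    n = refl
odd-* (suc m) n rewrite odd-+ n (m * n) | odd-* m n with odd m | odd n
... | true  | true  = refl
... | true  | false = refl
... | false | true  = refl
... | false | false = refl

halve : ∀ n → (∃ λ k → n ≡ 2 * k) ⊎ (∃ λ k → n ≡ 1 + 2 * k)
halve zero = inj₁ (0 , refl)
halve (suc n) with halve n
... | inj₁ (k , refl) = inj₂ (k , refl)
... | inj₂ (k , refl) = inj₁ (suc k , solve (k ∷ []))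

odd⇒1+2* : ∀ n → odd n ≡ true → ∃ λ k → n ≡ 1 + 2 * k
odd⇒1+2* n o with halve n
... | inj₁ (k , refl) = contradiction (trans (sym o) (odd-* 2 k)) λ ()
... | inj₂ p = p

odd-1+2* : ∀ k → odd (1 + 2 * k) ≡ true
odd-1+2* k = cong not (odd-* 2 k)

-- The half indicator and its symmetries.

-- The parity of ⌊x / N⌋ (junk value false for N = 0).
opaque
  F : ℕ → ℕ → Bool
  F zero    x = false
  F (suc N) x = odd (x / suc N)

  -- The way to all values of `F` below: exhibiting the quotient by two inequalities replaces
  -- computing a division.
  F-eval : ∀ {N x} q → q * N ≤ x → x < suc q * N → F N x ≡ odd q
  F-eval {zero} {x} q l u = contradiction u λ x<0 → n≮0 (subst (x <_) (*-zeroʳ q) x<0)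
  F-eval {suc N} {x} q l u = cong odd (≤-antisym
    (s≤s⁻¹ (m<n*o⇒m/o<n u))
    (subst (_≤ x / suc N) (m*n/n≡m q (suc N)) (/-monoˡ-≤ (suc N) l)))

division : ∀ {N} x → 0 < N → ∃ λ q → q * N ≤ x × x < suc q * N
division {suc N} x _ = x / suc N ,
  subst (x / suc N * suc N ≤_) (sym e) (m≤n+m _ (x % suc N)) ,
  subst (_< suc (x / suc N) * suc N) (sym e) (+-monoˡ-< _ (m%n<n x (suc N)))
  where e = m≡m%n+[m/n]*n x (suc N)

F-shift : ∀ {N} x k → 0 < N → F N (x + k * N) ≡ odd k xor F N x
F-shift {N} x k 0<N with division x 0<N
... | q , l , u = begin
  F N (x + k * N)   ≡⟨ F-eval (k + q) (by-linear 0 l (solve (k ∷ q ∷ N ∷ x ∷ [])))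
                                      (by-linear 0 u (solve (k ∷ q ∷ N ∷ x ∷ []))) ⟩
  odd (k + q)       ≡⟨ odd-+ k q ⟩
  odd k xor odd q   ≡⟨ cong (odd k xor_) (F-eval q l u) ⟨
  odd k xor F N x   ∎
  where open ≡-Reasoning

F-shift-even : ∀ {N} x k → 0 < N → F N (x + k * (2 * N)) ≡ F N x
F-shift-even {N} x k 0<N = begin
  F N (x + k * (2 * N))    ≡⟨ cong (F N) {x = x + k * (2 * N)} {y = x + 2 * k * N} (solve (x ∷ k ∷ N ∷ [])) ⟩
  F N (x + 2 * k * N)      ≡⟨ F-shift x (2 * k) 0<N ⟩
  odd (2 * k) xor F N x    ≡⟨ cong (_xor F N x) (odd-* 2 k) ⟩
  F N x                    ∎
  where open ≡-Reasoning

F-scale : ∀ {N} c x → 0 < N → 0 < c → F (c * N) (c * x) ≡ F N x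
F-scale {N} c x 0<N 0<c with division x 0<N
... | q , l , u = trans
  (F-eval q (subst (_≤ c * x) (commute q) (*-monoʳ-≤ c l))
            (subst (c * x <_) (commute (suc q)) (*-monoʳ-< c {{>-nonZero 0<c}} u)))
  (sym (F-eval q l u))
  where
  commute : ∀ r → c * (r * N) ≡ r * (c * N)
  commute r = solve (c ∷ r ∷ N ∷ [])

-- The reflection x ↦ kN - x carries the open interval from qN to (q + 1)N onto the one with index k
-- - 1 - q. Multiples of N would fall into the neighbouring interval, hence the hypothesis on a.
F-reflect : ∀ {N} a b k → ¬ (N ∣ a) → a + b ≡ k * N → F N b ≡ not (odd k xor F N a)
F-reflect {zero} zero b k N∤a eq = contradiction (0 ∣0) N∤a
F-reflect {zero} (suc a) b k N∤a eq = contradiction (trans eq (*-zeroʳ k)) λ ()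
F-reflect {N@(suc _)} a b k N∤a eq with division {N} a z<s
... | q , l , u with m≤n⇒∃[o]m+o≡n (*-cancelʳ-< N q k (<-≤-trans
      (≤∧≢⇒< l λ e → N∤a (divides q (sym e))) (subst (a ≤_) eq (m≤m+n a b))))
... | p , refl = begin
  F N b                                     ≡⟨ F-eval p lower upper ⟩
  odd p                                     ≡⟨ boole (odd q) (odd p) ⟩
  not (not (odd q xor odd p) xor odd q)     ≡⟨ cong₂ (λ s t → not (not s xor t)) (odd-+ q p) (F-eval q l u) ⟨
  not (odd (suc q + p) xor F N a)           ∎
  where
  open ≡-Reasoning
  qN<a : q * N < a
  qN<a = ≤∧≢⇒< l λ e → N∤a (divides q (sym e))
  lower : p * N ≤ b
  lower = <⇒≤ (+-cancelˡ-< a _ _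
      (subst (a + p * N <_) (trans (sym (*-distribʳ-+ N (suc q) p)) (sym eq)) (+-monoˡ-< (p * N) u)))
  upper : b < suc p * N
  upper = +-cancelˡ-< (q * N) _ _ (subst (q * N + b <_) (trans eq e) (+-monoˡ-< b qN<a))
    where
    e : (suc q + p) * N ≡ q * N + suc p * N
    e = trans (cong (_* N) (sym (+-suc q p))) (*-distribʳ-+ N q (suc p))
  boole : ∀ s t → t ≡ not (not (s xor t) xor s)
  boole true  true  = refl
  boole true  false = refl
  boole false true  = refl
  boole false false = refl

F-low : ∀ {N x} → x < N → F N x ≡ false
F-low {N} {x} x<N = F-eval 0 z≤n (subst (x <_) (sym (+-identityʳ N)) x<N)

F-high : ∀ {N x} → N ≤ x → x < 2 * N → F N x ≡ true
F-high {N} {x} N≤x x<2N = F-eval 1 (subst (_≤ x) (sym (+-identityʳ N)) N≤x) x<2N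

-- Units built from powers of two.

coprime-*ʳ : ∀ {u a b} → Coprime u a → Coprime u b → Coprime u (a * b)
coprime-*ʳ u⊥a u⊥b (d∣u , d∣ab) =
  u⊥b (d∣u , coprime-divisor (λ (e∣d , e∣a) → u⊥a (∣-trans e∣d d∣u , e∣a)) d∣ab)

coprime-+* : ∀ {v n} k → Coprime v n → Coprime (v + k * n) n
coprime-+* {v} {n} k v⊥n {d} (d∣v+kn , d∣n) =
  v⊥n (∣m+n∣m⇒∣n (subst (d ∣_) (+-comm v (k * n)) d∣v+kn) (∣n⇒∣m*n k d∣n) , d∣n)

odd⇒coprime-2 : ∀ {u} → odd u ≡ true → Coprime u 2
odd⇒coprime-2 {u} o (d∣u , d∣2) = go d∣u d∣2 (∣⇒≤ d∣2)
  where
  go : ∀ {d} → d ∣ u → d ∣ 2 → d ≤ 2 → d ≡ 1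
  go {0} _ 0∣2 _ = contradiction (0∣⇒≡0 0∣2) λ ()
  go {1} _ _ _ = refl
  go {2} (divides q refl) _ _ =
    contradiction (trans (sym o) (trans (cong odd (*-comm q 2)) (odd-* 2 q))) λ ()
  go {suc (suc (suc _))} _ _ (s≤s (s≤s ()))

coprime-2*⇒odd : ∀ {u N} → Coprime u (2 * N) → odd u ≡ true
coprime-2*⇒odd {u} {N} u⊥2N with halve u
... | inj₁ (k , refl) = contradiction (u⊥2N {2} (m∣m*n k , m∣m*n N)) λ ()
... | inj₂ (k , refl) = odd-1+2* k

coprime-2* : ∀ {u N} → odd u ≡ true → Coprime u N → Coprime u (2 * N)
coprime-2* o = coprime-*ʳ (odd⇒coprime-2 o)

coprime-2^ : ∀ {n} j → odd n ≡ true → Coprime (2 ^ j) n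
coprime-2^ zero    o = 1-coprimeTo _
coprime-2^ (suc j) o = coprime-sym (coprime-*ʳ (odd⇒coprime-2 o) (coprime-sym (coprime-2^ j o)))

-- Doubling past a threshold; d ≡ 2 mod 4.

n<2^n : ∀ n → n < 2 ^ n
n<2^n zero    = z<s
n<2^n (suc n) = ≤-trans (+-mono-≤ (≤-trans z<s (n<2^n n)) (n<2^n n)) (+-monoʳ-≤ (2 ^ n) (m≤m+n _ 0))

-- Finds the doubling of e that first crosses M: it lands in [M, 2M), the high half.
doubling : ∀ {e M} → 0 < e → e < M → ∃ λ j → 2 ^ j * e < M × M ≤ 2 ^ suc j * e
doubling {e} {M} 0<e e<M = search M (≤-trans (<⇒≤ (n<2^n M))
    (subst (_≤ 2 ^ M * e) (*-identityʳ (2 ^ M)) (*-monoʳ-≤ (2 ^ M) 0<e)))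
  where
  search : ∀ J → M ≤ 2 ^ J * e → ∃ λ j → 2 ^ j * e < M × M ≤ 2 ^ suc j * e
  search zero    b = contradiction (subst (M ≤_) (+-identityʳ e) b) (<⇒≱ e<M)
  search (suc J) b with M ≤? 2 ^ J * e
  ... | yes b′ = search J b′
  ... | no ¬b  = J , ≰⇒> ¬b , b

-- When the doublings of g first reach M, the power of two itself is still low, because 2^(j+1) ≤
-- 2^j g < M for g ≥ 2.
powers-of-two-separate : ∀ {M g} → (∀ j → F M (g * 2 ^ suc j) ≡ F M (2 ^ suc j)) → 1 < g → g < M → ⊥
powers-of-two-separate {M} {g} same 1<g g<M with doubling (<-trans z<s 1<g) g<M
... | j , below , above = contradiction
  (trans (sym (F-high (subst (M ≤_) (*-comm (2 ^ suc j) g) above) (upper (2 ^ j) below)))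
    (trans (same j) (F-low (lower (2 ^ j) below)))) λ ()
  where
  upper : ∀ p → p * g < M → g * (2 * p) < 2 * M
  upper p b = subst (_< 2 * M) (lemma p) (*-monoʳ-< 2 b)
    where
    lemma : ∀ p → 2 * (p * g) ≡ g * (2 * p)
    lemma p = solve (p ∷ g ∷ [])
  lower : ∀ p → p * g < M → 2 * p < M
  lower p b = ≤-<-trans (subst (_≤ p * g) (*-comm p 2) (*-monoʳ-≤ p 1<g)) b

-- With d = 2N, multiplication by g maps the residues in (0, d/2) prime to d to themselves.
Preserves : ℕ → ℕ → Set
Preserves N g = ∀ u → Coprime u (2 * N) → F N (g * u) ≡ F N u

preserves⇒low : ∀ {N g} → 1 < N → Preserves N g → F N g ≡ false
preserves⇒low {N} {g} 1<N pres =
  trans (cong (F N) (sym (*-identityʳ g))) (trans (pres 1 (1-coprimeTo _)) (F-low 1<N))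

low⇒< : ∀ {N g} → F N g ≡ false → g < 2 * N → g < N
low⇒< {N} {g} low g<2N = ≰⇒> λ N≤g → contradiction (trans (sym low) (F-high N≤g g<2N)) λ ()

-- Even powers of two are not units here, but adding the odd m makes them so. Since g is odd, both
-- sides of the preservation equation are shifted by an odd multiple of m; the two flips cancel and
-- leave the equation for the bare power.
no-preserver-2mod4 : ∀ {m g} → odd m ≡ true → odd g ≡ true → Preserves m g → 1 < g → g < 2 * m → ⊥
no-preserver-2mod4 {0} () _ _ _ _
no-preserver-2mod4 {1} _ _ _ 1<g g<2 = n≮n 1 (≤-trans 1<g (s≤s⁻¹ g<2))
no-preserver-2mod4 {m@(suc (suc _))} {g} om og pres 1<g g<2m =
  powers-of-two-separate same 1<g (low⇒< (preserves⇒low (s≤s z<s) pres) g<2m)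
  where
  same : ∀ j → F m (g * 2 ^ suc j) ≡ F m (2 ^ suc j)
  same j = xor-cancel (F m (g * t)) (F m t) (begin
    true xor F m (g * t)      ≡⟨ cong (_xor F m (g * t)) og ⟨
    odd g xor F m (g * t)     ≡⟨ F-shift (g * t) g z<s ⟨
    F m (g * t + g * m)       ≡⟨ cong (F m)
        (trans (sym (*-distribˡ-+ g t m)) (cong (λ x → g * (t + x)) (sym (*-identityˡ m)))) ⟩
    F m (g * (t + 1 * m))     ≡⟨ pres (t + 1 * m) (coprime-2* odd-u (coprime-+* 1 (coprime-2^ (suc j) om))) ⟩
    F m (t + 1 * m)           ≡⟨ F-shift t 1 z<s ⟩
    true xor F m t            ∎)
    where
    open ≡-Reasoning
    t = 2 ^ suc j
    odd-u : odd (t + 1 * m) ≡ true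
    odd-u = trans (odd-+ t (1 * m)) (cong₂ _xor_ (odd-* 2 (2 ^ j)) (trans (cong odd (*-identityˡ m)) om))
    xor-cancel : ∀ a b → true xor a ≡ true xor b → a ≡ b
    xor-cancel true  true  _ = refl
    xor-cancel false false _ = refl

-- Reflection, and d = 4n with n odd and g ≡ 1 mod 4.

preserves-mod : ∀ {N g} k → 0 < N → Preserves N (g + k * (2 * N)) → Preserves N g
preserves-mod {N} {g} k 0<N pres u u⊥2N = begin
  F N (g * u)                          ≡⟨ F-shift-even (g * u) (k * u) 0<N ⟨
  F N (g * u + k * u * (2 * N))        ≡⟨ cong (F N) lemma ⟩
  F N ((g + k * (2 * N)) * u)          ≡⟨ pres u u⊥2N ⟩
  F N u                                ∎
  where
  open ≡-Reasoning
  lemma : g * u + k * u * (2 * N) ≡ (g + k * (2 * N)) * u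
  lemma = solve (g ∷ k ∷ u ∷ N ∷ [])

2*∤odd : ∀ {n x} → odd x ≡ true → ¬ (2 * n ∣ x)
2*∤odd {n} o (divides q refl) = contradiction (trans (sym o) (trans (cong odd lemma) (odd-* 2 (q * n)))) λ ()
  where
  lemma : q * (2 * n) ≡ 2 * (q * n)
  lemma = solve (q ∷ n ∷ [])

-- For a unit u, which is odd, gu and g′u add up to an odd multiple of N = 2n, and such a reflection
-- keeps the half: negation and the shift by d/2 each swap the halves.
preserves-reflect : ∀ {n g g′} → odd g ≡ true → g + g′ ≡ 2 * n →
  Preserves (2 * n) g → Preserves (2 * n) g′
preserves-reflect {n} {g} {g′} og sum pres u u⊥2N = begin
  F (2 * n) (g′ * u)                          ≡⟨ F-reflect (g * u) (g′ * u) u (2*∤odd {n} odd-gu) lemma ⟩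
  not (odd u xor F (2 * n) (g * u))           ≡⟨ cong (λ b → not (b xor F (2 * n) (g * u))) odd-u ⟩
  not (not (F (2 * n) (g * u)))               ≡⟨ not-involutive _ ⟩
  F (2 * n) (g * u)                           ≡⟨ pres u u⊥2N ⟩
  F (2 * n) u                                 ∎
  where
  open ≡-Reasoning
  odd-u : odd u ≡ true
  odd-u = coprime-2*⇒odd {u} {2 * n} u⊥2N
  odd-gu : odd (g * u) ≡ true
  odd-gu = trans (odd-* g u) (cong₂ _∧_ og odd-u)
  lemma : g * u + g′ * u ≡ u * (2 * n)
  lemma = trans (sym (*-distribʳ-+ u g g′)) (trans (cong (_* u) sum) (*-comm (2 * n) u))

coprime-2^+odd : ∀ {n} j → odd n ≡ true → Coprime (2 ^ suc j + n) (2 * (2 * n))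
coprime-2^+odd {n} j on = coprime-2* odd-u (coprime-2* odd-u
    (subst (λ x → Coprime (2 ^ suc j + x) n) (*-identityˡ n) (coprime-+* 1 (coprime-2^ (suc j) on))))
  where
  odd-u : odd (2 ^ suc j + n) ≡ true
  odd-u = trans (odd-+ (2 ^ suc j) n) (cong₂ _xor_ (odd-* 2 (2 ^ j)) on)

odd⇒pos : ∀ {n} → odd n ≡ true → 0 < n
odd⇒pos {suc n} _ = z<s

2*-pos : ∀ {n} → 0 < n → 0 < 2 * n
2*-pos 0<n = ≤-trans 0<n (m≤m+n _ _)

-- As gn ≡ n mod 4n, the units t + n compare gt + n with t + n. Under this offset x is low for x < n
-- and high for n ≤ x < 3n, so the first power t that takes gt past n separates the two.
no-small-preserver-1mod4 : ∀ {n} a → odd n ≡ true → 0 < a → 1 + 4 * a ≤ n → Preserves (2 * n) (1 + 4 * a) → ⊥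
no-small-preserver-1mod4 {n} a on 0<a g≤n pres = conclude (doubling (2*-pos {g} z<s) 2g<n)
  where
  g = 1 + 4 * a
  same : ∀ j → F (2 * n) (g * 2 ^ suc j + n) ≡ F (2 * n) (2 ^ suc j + n)
  same j = begin
    F (2 * n) (g * t + n)                        ≡⟨ F-shift-even (g * t + n) a (2*-pos (odd⇒pos {n} on)) ⟨
    F (2 * n) (g * t + n + a * (2 * (2 * n)))    ≡⟨ cong (F (2 * n)) (lemma t) ⟩
    F (2 * n) (g * (t + n))                      ≡⟨ pres (t + n) (coprime-2^+odd j on) ⟩
    F (2 * n) (t + n)                            ∎
    where
    open ≡-Reasoning
    t = 2 ^ suc j
    lemma : ∀ t → (1 + 4 * a) * t + n + a * (2 * (2 * n)) ≡ (1 + 4 * a) * (t + n)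
    lemma t = solve (a ∷ t ∷ n ∷ [])
  5≤n : 5 ≤ n
  5≤n = ≤-trans (+-monoʳ-≤ 1 (*-monoʳ-≤ 4 0<a)) g≤n
  disagree : ∀ {x y} → n ≤ x → x < 3 * n → y < n → F (2 * n) (x + n) ≡ F (2 * n) (y + n) → ⊥
  disagree {x} {y} n≤x x<3n y<n eq = contradiction
    (trans (sym (F-high {2 * n} {x + n} (by-linear 0 n≤x (solve (n ∷ x ∷ [])))
        (by-linear 0 x<3n (solve (n ∷ x ∷ [])))))
      (trans eq (F-low {2 * n} {y + n} (by-linear 0 y<n (solve (n ∷ y ∷ [])))))) λ ()
  -- The case t = 2: for n ≤ 2g the point 2g lies in [n, 3n) while 2 < n. The bound lets the
  -- doubling start from 2g, as every t in use is even.
  2g<n : 2 * g < n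
  2g<n = ≰⇒> λ n≤2g → disagree (subst (n ≤_) (*-comm 2 g) n≤2g)
    (≤-<-trans (*-monoˡ-≤ 2 g≤n) (subst (_< 3 * n) (*-comm 2 n)
        (*-monoˡ-< n {{>-nonZero (odd⇒pos {n} on)}} (n<1+n 2))))
    (≤-trans (m≤m+n 3 2) 5≤n) (same 0)
  conclude : (∃ λ j → 2 ^ j * (2 * g) < n × n ≤ 2 ^ suc j * (2 * g)) → ⊥
  conclude (j , below , above) = disagree
      (subst (n ≤_) (lemma₁ (2 ^ j)) above)
      (<-≤-trans (subst (_< 2 * n) (lemma₂ (2 ^ j)) (*-monoʳ-< 2 below)) (*-monoˡ-≤ n (n≤1+n 2)))
      (≤-<-trans (≤-trans (≤-reflexive (lemma₃ (2 ^ j)))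
          (*-monoʳ-≤ (2 ^ j) (*-monoʳ-≤ 2 (≤-trans (m≤m+n 2 3) (+-monoʳ-≤ 1 (*-monoʳ-≤ 4 0<a)))))) below)
      (same (suc j))
    where
    lemma₁ : ∀ p → 2 * p * (2 * (1 + 4 * a)) ≡ (1 + 4 * a) * (2 * (2 * p))
    lemma₁ p = solve (p ∷ a ∷ [])
    lemma₂ : ∀ p → 2 * (p * (2 * (1 + 4 * a))) ≡ (1 + 4 * a) * (2 * (2 * p))
    lemma₂ p = solve (p ∷ a ∷ [])
    lemma₃ : ∀ p → 2 * (2 * p) ≡ p * (2 * 2)
    lemma₃ p = solve (p ∷ [])

-- For n = 1 + 2b the reflection g ↦ 2n - g exchanges a with c = b - a, and the smaller of the two
-- gives a multiplier at most n. The case c = 0 is g = 2n - 1.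
preserver-4odd-1mod4 : ∀ {n} a → odd n ≡ true → 1 + 4 * a < 2 * (2 * n) → Preserves (2 * n) (1 + 4 * a) →
  a ≡ 0 ⊎ suc (1 + 4 * a) ≡ 2 * n
preserver-4odd-1mod4 zero on _ _ = inj₁ refl
preserver-4odd-1mod4 {n} a@(suc _) on g<4n pres with odd⇒1+2* n on
... | b , refl = inj₂ (go (b ∸ a) (m+[n∸m]≡n a≤b))
  where
  g<2n : 1 + 4 * a < 2 * (1 + 2 * b)
  g<2n = low⇒< {2 * (1 + 2 * b)} {1 + 4 * a}
      (preserves⇒low {2 * (1 + 2 * b)} {1 + 4 * a} (*-monoʳ-≤ 2 (s≤s z≤n)) pres) g<4n
  a≤b : a ≤ b
  a≤b = s≤s⁻¹ (*-cancelˡ-< 4 a (suc b) (by-linear 3 g<2n (lemma a)))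
    where
    lemma : ∀ a → suc (4 * a) + 3 + 2 * (1 + 2 * b) ≡ suc (1 + 4 * a) + 4 * suc b
    lemma a = solve (a ∷ b ∷ [])
  go : ∀ c → a + c ≡ b → suc (1 + 4 * a) ≡ 2 * (1 + 2 * b)
  go zero refl = trans (cong (λ x → suc (1 + 4 * x)) (sym (+-identityʳ a))) (lemma (a + 0))
    where
    lemma : ∀ x → suc (1 + 4 * x) ≡ 2 * (1 + 2 * x)
    lemma x = solve (x ∷ [])
  go c@(suc _) refl with ≤-total a c
  ... | inj₁ a≤c = ⊥-elim (no-small-preserver-1mod4 a on z<s
          (s≤s (subst (_≤ 2 * (a + c)) (lemma a) (*-monoʳ-≤ 2 (+-monoʳ-≤ a a≤c)))) pres)
    where
    lemma : ∀ x → 2 * (x + x) ≡ 4 * x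
    lemma x = solve (x ∷ [])
  ... | inj₂ c≤a = ⊥-elim (no-small-preserver-1mod4 c on z<s
          (s≤s (subst (_≤ 2 * (a + c)) (lemma₁ c) (*-monoʳ-≤ 2 (+-monoˡ-≤ c c≤a))))
          (preserves-reflect {n = 1 + 2 * (a + c)} {g = 1 + 4 * a} (cong not (odd-* 4 a)) (lemma₂ a c) pres))
    where
    lemma₁ : ∀ x → 2 * (x + x) ≡ 4 * x
    lemma₁ x = solve (x ∷ [])
    lemma₂ : ∀ x y → 1 + 4 * x + (1 + 4 * y) ≡ 2 * (1 + 2 * (x + y))
    lemma₂ x y = solve (x ∷ y ∷ [])

-- Descent from 8k to 4k for g ≡ 1 mod 4.

-- With q = ⌊x/M⌋ this is ⌊q/2⌋ + ⌊(q + 1)/2⌋ = q read modulo 2.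
F-halve : ∀ {M} x → 0 < M → F M x ≡ F (2 * M) x xor F (2 * M) (x + M)
F-halve {M} x 0<M with division x 0<M
... | q , l , u with halve q
... | inj₁ (c , refl) = trans (F-eval q l u) (trans (odd-* 2 c) (sym (trans (cong₂ _xor_
    (F-eval c (by-linear 0 l (solve (c ∷ M ∷ x ∷ []))) (by-linear M u (solve (c ∷ M ∷ x ∷ []))))
    (F-eval c (by-linear M l (solve (c ∷ M ∷ x ∷ []))) (by-linear 0 u (solve (c ∷ M ∷ x ∷ [])))))
    (xor-same (odd c)))))
... | inj₂ (c , refl) = trans (F-eval q l u) (trans (odd-1+2* c) (sym (trans (cong₂ _xor_
    (F-eval c (by-linear M l (solve (c ∷ M ∷ x ∷ []))) (by-linear 0 u (solve (c ∷ M ∷ x ∷ []))))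
    (F-eval (suc c) (by-linear 0 l (solve (c ∷ M ∷ x ∷ []))) (by-linear M u (solve (c ∷ M ∷ x ∷ [])))))
    (xor-not (odd c)))))
    where
    xor-not : ∀ s → s xor not s ≡ true
    xor-not true  = refl
    xor-not false = refl

-- By `F-halve` it suffices to control the points shifted by 2k, and the unit 1 + 2k supplies the
-- shift: for u = 1 + 2c the product u(1 + 2k) is u + 2k + cN. Multiplied by g = 1 + 4a it gives gu
-- + 2k + cN up to a multiple of 2N, so the same flip by c occurs on both sides.
preserves-halve : ∀ {k} a → 0 < k → Preserves (2 * (2 * k)) (1 + 4 * a) → Preserves (2 * k) (1 + 4 * a)
preserves-halve {k} a 0<k pres u u⊥4k with odd⇒1+2* u (coprime-2*⇒odd {u} {2 * k} u⊥4k)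
... | c , refl = begin
  F (2 * k) x                                    ≡⟨ F-halve x 0<2k ⟩
  F N x xor F N (x + 2 * k)                      ≡⟨ cong₂ _xor_ (pres u u⊥8k) shifted ⟩
  F N u xor F N (u + 2 * k)                      ≡⟨ F-halve u 0<2k ⟨
  F (2 * k) u                                    ∎
  where
  open ≡-Reasoning
  N = 2 * (2 * k)
  x = (1 + 4 * a) * u
  0<2k = 2*-pos 0<k
  0<N = 2*-pos 0<2k
  u⊥8k : Coprime u (2 * N)
  u⊥8k = coprime-2* (odd-1+2* c) u⊥4k
  1+2k⊥8k : Coprime (1 + 2 * k) (2 * N)
  1+2k⊥8k = coprime-2* (odd-1+2* k) (coprime-2* (odd-1+2* k) (coprime-2* (odd-1+2* k) (coprime-+* 2 (1-coprimeTo k))))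
  v⊥8k : Coprime (u * (1 + 2 * k)) (2 * N)
  v⊥8k = coprime-sym (coprime-*ʳ (coprime-sym u⊥8k) (coprime-sym 1+2k⊥8k))
  cancel : ∀ s {p q} → s xor p ≡ s xor q → p ≡ q
  cancel false e = e
  cancel true {true}  {true}  e = refl
  cancel true {false} {false} e = refl
  shifted : F N (x + 2 * k) ≡ F N (u + 2 * k)
  shifted = cancel (odd c) (begin
    odd c xor F N (x + 2 * k)                       ≡⟨ F-shift (x + 2 * k) c 0<N ⟨
    F N (x + 2 * k + c * N)                         ≡⟨ F-shift-even (x + 2 * k + c * N) (a * u) 0<N ⟨
    F N (x + 2 * k + c * N + a * u * (2 * N))       ≡⟨ cong (F N) lemma₁ ⟩
    F N ((1 + 4 * a) * (u * (1 + 2 * k)))           ≡⟨ pres (u * (1 + 2 * k)) v⊥8k ⟩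
    F N (u * (1 + 2 * k))                           ≡⟨ cong (F N) lemma₂ ⟩
    F N (u + 2 * k + c * N)                         ≡⟨ F-shift (u + 2 * k) c 0<N ⟩
    odd c xor F N (u + 2 * k)                       ∎)
    where
    lemma₁ : (1 + 4 * a) * (1 + 2 * c) + 2 * k + c * (2 * (2 * k)) + a * (1 + 2 * c) * (2 * (2 * (2 * k))) ≡
        (1 + 4 * a) * ((1 + 2 * c) * (1 + 2 * k))
    lemma₁ = solve (a ∷ c ∷ k ∷ [])
    lemma₂ : (1 + 2 * c) * (1 + 2 * k) ≡ 1 + 2 * c + 2 * k + c * (2 * (2 * k))
    lemma₂ = solve (c ∷ k ∷ [])

scale-≤ : ∀ {x y} c → x ≤ y → c * x ≤ c * y
scale-≤ c = *-monoʳ-≤ c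

preserves-high : ∀ {N g} → 1 < N → Preserves N g → N ≤ g → g < 2 * N → ⊥
preserves-high {N} {g} 1<N pres N≤g g<2N = <⇒≱ (low⇒< (preserves⇒low {N} {g} 1<N pres) g<2N) N≤g

-- A certificate by one low unit u with high image: r and k are the remainder and quotient of gu by
-- d = 2N.
not-preserves : ∀ {N g} u k r → Coprime u (2 * N) → u < N → N ≤ r → r < 2 * N →
  g * u ≡ r + k * (2 * N) → Preserves N g → ⊥
not-preserves {N} {g} u k r u⊥2N u<N N≤r r<2N eq pres = contradiction
  (begin
    true                    ≡⟨ F-high N≤r r<2N ⟨
    F N r                   ≡⟨ F-shift-even r k (≤-<-trans z≤n u<N) ⟨
    F N (r + k * (2 * N))   ≡⟨ cong (F N) eq ⟨
    F N (g * u)             ≡⟨ pres u u⊥2N ⟩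
    F N u                   ≡⟨ F-low u<N ⟩
    false                   ∎) λ ()
  where open ≡-Reasoning

-- The three cases say that g = 1 + 4a is 1 mod 4n, is 2n - 1 mod 4n, or is 5 mod 24 with 4n = 24.
Exceptional : ℕ → ℕ → Set
Exceptional n a =
  (∃ λ k → a ≡ k * n)
  ⊎ (odd n ≡ true × ∃ λ k → 1 + 2 * a ≡ (1 + 2 * k) * n)
  ⊎ (n ≡ 6 × ∃ λ k → a ≡ 1 + k * 6)

-- Put t = 1 + 2b, so that d = 8t and g = 2t - 1. Modulo 8t, 2t² is 2t for t ≡ 1 mod 4 and 6t for t
-- ≡ 3 mod 4. Hence the unit t + 2 goes to 5t - 2 in the first case and t + 4 goes to 5t - 4 in the
-- second; these reach 4t for t ≥ 5, but not for t = 3.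
not-preserves-2t-1 : ∀ b → 2 ≤ b → Preserves (2 * (2 * (1 + 2 * b))) (1 + 4 * b) → ⊥
not-preserves-2t-1 b 2≤b pres with halve b
... | inj₁ (c , refl) = not-preserves {2 * (2 * (1 + 2 * (2 * c)))} {1 + 4 * (2 * c)}
      (2 + (1 + 2 * (2 * c))) c (3 + 20 * c)
    (coprime-2* {2 + (1 + 2 * (2 * c))} {2 * (2 * (1 + 2 * (2 * c)))}
        (trans (odd-+ 2 (1 + 2 * (2 * c))) (odd-1+2* (2 * c)))
          (coprime-2^+odd {1 + 2 * (2 * c)} 0 (odd-1+2* (2 * c))))
    (by-linear (12 * c) (z≤n {0}) (solve (c ∷ [])))
    (by-linear 3 (scale-≤ 2 2≤b) (solve (c ∷ [])))
    (by-linear (4 + 12 * c) (z≤n {0}) (solve (c ∷ [])))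
    (lemma c) pres
  where
  lemma : ∀ c → (1 + 4 * (2 * c)) * (2 + (1 + 2 * (2 * c))) ≡ 3 + 20 * c + c * (2 * (2 * (2 * (1 + 2 * (2 * c)))))
  lemma c = solve (c ∷ [])
... | inj₂ (c , refl) = not-preserves {2 * (2 * (1 + 2 * (1 + 2 * c)))} {1 + 4 * (1 + 2 * c)}
      (4 + (1 + 2 * (1 + 2 * c))) (suc c) (11 + 20 * c)
    (coprime-2* {4 + (1 + 2 * (1 + 2 * c))} {2 * (2 * (1 + 2 * (1 + 2 * c)))}
        (trans (odd-+ 4 (1 + 2 * (1 + 2 * c))) (odd-1+2* (1 + 2 * c)))
          (coprime-2^+odd {1 + 2 * (1 + 2 * c)} 1 (odd-1+2* (1 + 2 * c))))
    (by-linear (4 + 12 * c) (z≤n {0}) (solve (c ∷ [])))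
    (by-linear (2 * c) 2≤b′ (solve (c ∷ [])))
    (by-linear (12 + 12 * c) (z≤n {0}) (solve (c ∷ [])))
    (lemma c) pres
  where
  2≤b′ : 1 ≤ 2 * c
  2≤b′ = s≤s⁻¹ 2≤b
  lemma : ∀ c → (1 + 4 * (1 + 2 * c)) * (4 + (1 + 2 * (1 + 2 * c))) ≡
      11 + 20 * c + suc c * (2 * (2 * (2 * (1 + 2 * (1 + 2 * c)))))
  lemma c = solve (c ∷ [])

-- The descent keeps g while the modulus shrinks, so g may exceed 4n; the classification is applied
-- to its remainder, that is, to a modulo n.
exceptional-odd : ∀ {n} a → odd n ≡ true → Preserves (2 * n) (1 + 4 * a) → Exceptional n a
exceptional-odd {n} a on pres with division {n} a (odd⇒pos {n} on)
... | q , l , u with preserver-4odd-1mod4 {n} (a ∸ q * n) on small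
        (preserves-mod {2 * n} {1 + 4 * (a ∸ q * n)} q (2*-pos (odd⇒pos {n} on)) (subst (Preserves (2 * n)) eq pres))
  where
  r = a ∸ q * n
  a≡ : r + q * n ≡ a
  a≡ = m∸n+n≡m l
  r<n : r < n
  r<n = +-cancelʳ-< (q * n) r n (subst (_< n + q * n) (sym a≡) u)
  small : 1 + 4 * r < 2 * (2 * n)
  small = by-linear 2 (scale-≤ 4 r<n) (lemma r)
    where
    lemma : ∀ r → suc (1 + 4 * r) + 2 + 4 * n ≡ 4 * suc r + 2 * (2 * n)
    lemma r = solve (r ∷ n ∷ [])
  eq : 1 + 4 * a ≡ 1 + 4 * r + q * (2 * (2 * n))
  eq = trans (cong (λ x → 1 + 4 * x) (sym a≡)) (lemma r)
    where
    lemma : ∀ r → 1 + 4 * (r + q * n) ≡ 1 + 4 * r + q * (2 * (2 * n))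
    lemma r = solve (r ∷ q ∷ n ∷ [])
... | inj₁ r≡0 = inj₁ (q , trans (sym (m∸n+n≡m l)) (cong (_+ q * n) r≡0))
... | inj₂ e = inj₂ (inj₁ (on , q , *-cancelˡ-≡ _ _ 2 (trans
    (cong (λ x → 2 * (1 + 2 * x)) (sym (m∸n+n≡m l)))
        (trans (lemma₁ (a ∸ q * n)) (trans (cong (_+ q * (2 * (2 * n))) e) lemma₂)))))
  where
  lemma₁ : ∀ r → 2 * (1 + 2 * (r + q * n)) ≡ suc (1 + 4 * r) + q * (2 * (2 * n))
  lemma₁ r = solve (r ∷ q ∷ n ∷ [])
  lemma₂ : 2 * n + q * (2 * (2 * n)) ≡ 2 * ((1 + 2 * q) * n)
  lemma₂ = solve (q ∷ n ∷ [])

-- A residue r modulo 4k lifts to r and r + 4k modulo 8k. The upper lift is high, which the unit 1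
-- refutes. The lower lift remains exceptional unless r = 2k - 1 with k ≥ 5 or r = 5 with 4k = 24,
-- and those need a further unit.
exceptional-double : ∀ {k} a → 0 < k → Preserves (2 * (2 * k)) (1 + 4 * a) → Exceptional k a → Exceptional (2 * k) a
exceptional-double {k} a 0<k pres (inj₁ (j , refl)) with halve j
... | inj₁ (i , refl) = inj₁ (i , lemma)
  where
  lemma : 2 * i * k ≡ i * (2 * k)
  lemma = solve (i ∷ k ∷ [])
... | inj₂ (i , refl) = ⊥-elim (preserves-high {2 * (2 * k)} {1 + 4 * k}
      (by-linear 2 (scale-≤ 4 0<k) (solve (k ∷ [])))
      (preserves-mod {2 * (2 * k)} {1 + 4 * k} i (2*-pos (2*-pos 0<k)) (subst (Preserves (2 * (2 * k))) lemma pres))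
      (by-linear 1 (z≤n {0}) (solve (k ∷ [])))
      (by-linear 2 (scale-≤ 4 0<k) (solve (k ∷ []))))
  where
  lemma : 1 + 4 * ((1 + 2 * i) * k) ≡ 1 + 4 * k + i * (2 * (2 * (2 * k)))
  lemma = solve (i ∷ k ∷ [])
exceptional-double {k} a 0<k pres (inj₂ (inj₁ (ok , j , eq))) with odd⇒1+2* k ok
... | b , refl with a≡
  where
  a≡ : a ≡ b + j * (1 + 2 * b)
  a≡ = *-cancelˡ-≡ _ _ 2 (suc-injective (trans eq lemma))
    where
    lemma : (1 + 2 * j) * (1 + 2 * b) ≡ 1 + 2 * (b + j * (1 + 2 * b))
    lemma = solve (b ∷ j ∷ [])
... | refl with halve j
...   | inj₂ (i , refl) = ⊥-elim (preserves-high {2 * (2 * (1 + 2 * b))} {5 + 12 * b}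
      (by-linear (2 + 8 * b) (z≤n {0}) (solve (b ∷ [])))
      (preserves-mod {2 * (2 * (1 + 2 * b))} {5 + 12 * b} i z<s
          (subst (Preserves (2 * (2 * (1 + 2 * b)))) lemma pres))
      (by-linear (1 + 4 * b) (z≤n {0}) (solve (b ∷ [])))
      (by-linear (2 + 4 * b) (z≤n {0}) (solve (b ∷ []))))
  where
  lemma : 1 + 4 * (b + (1 + 2 * i) * (1 + 2 * b)) ≡ 5 + 12 * b + i * (2 * (2 * (2 * (1 + 2 * b))))
  lemma = solve (i ∷ b ∷ [])
...   | inj₁ (i , refl) = go b refl
  where
  go : ∀ b′ → b ≡ b′ → Exceptional (2 * (1 + 2 * b)) (b + 2 * i * (1 + 2 * b))
  -- Here k = 1 and 2k - 1 = 1, so the lift is the residue 1 modulo 8.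
  go 0 refl = inj₁ (i , trans (*-comm (2 * i) 1) lemma)
    where
    lemma : 1 * (2 * i) ≡ i * 2
    lemma = solve (i ∷ [])
  go 1 refl = inj₂ (inj₂ (refl , i , cong suc lemma))
    where
    lemma : 2 * i * 3 ≡ i * 6
    lemma = solve (i ∷ [])
  go (suc (suc c)) refl = ⊥-elim (not-preserves-2t-1 b (s≤s (s≤s z≤n))
      (preserves-mod {2 * (2 * (1 + 2 * b))} {1 + 4 * b} i z<s
          (subst (Preserves (2 * (2 * (1 + 2 * b)))) (lemma b) pres)))
    where
    lemma : ∀ b → 1 + 4 * (b + 2 * i * (1 + 2 * b)) ≡ 1 + 4 * b + i * (2 * (2 * (2 * (1 + 2 * b))))
    lemma b = solve (i ∷ b ∷ [])
exceptional-double a 0<k pres (inj₂ (inj₂ (refl , j , refl))) with halve j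
-- The unit 5 goes to 25, just past N = 24.
... | inj₁ (i , refl) = ⊥-elim (not-preserves {24} {5} 5 0 25 (gcd≡1⇒coprime refl)
      (m≤m+n 6 18) (m≤m+n 24 1) (m≤m+n 26 22) refl
      (preserves-mod {24} {5} i z<s (subst (Preserves 24) lemma pres)))
  where
  lemma : 1 + 4 * (1 + 2 * i * 6) ≡ 5 + i * (2 * 24)
  lemma = solve (i ∷ [])
... | inj₂ (i , refl) = ⊥-elim (preserves-high {24} {29} (m≤m+n 2 22)
      (preserves-mod {24} {29} i z<s (subst (Preserves 24) lemma pres)) (m≤m+n 24 5) (m≤m+n 30 18))
  where
  lemma : 1 + 4 * (1 + (1 + 2 * i) * 6) ≡ 29 + i * (2 * 24)
  lemma = solve (i ∷ [])

-- Strong induction: `preserves-halve` passes to n/2 with g unchanged, and `exceptional-double`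
-- lifts the answer using preservation at the larger modulus.
preserver-1mod4 : ∀ n a → 0 < n → Preserves (2 * n) (1 + 4 * a) → Exceptional n a
preserver-1mod4 = <-rec _ step
  where
  P : ℕ → Set
  P n = ∀ a → 0 < n → Preserves (2 * n) (1 + 4 * a) → Exceptional n a
  step : ∀ n → (∀ {m} → m < n → P m) → P n
  step n rec a 0<n pres with halve n
  ... | inj₂ (b , refl) = exceptional-odd a (odd-1+2* b) pres
  ... | inj₁ (k@(suc _) , refl) = exceptional-double a z<s pres (rec (m<m+n k z<s) a z<s (preserves-halve a z<s pres))

-- n odd and g ≡ 3 mod 4: g is within 1 of 2n/3.

2*2mod6 : ∀ {t} m → t ≡ 2 + 6 * m → 2 * t ≡ 4 + 6 * (2 * m)
2*2mod6 m refl = solve (m ∷ [])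

2*4mod6 : ∀ {t} m → t ≡ 4 + 6 * m → 2 * t ≡ 2 + 6 * (1 + 2 * m)
2*4mod6 m refl = solve (m ∷ [])

2^-mod6 : ∀ j → (∃ λ m → 2 ^ suc j ≡ 2 + 6 * m) ⊎ (∃ λ m → 2 ^ suc j ≡ 4 + 6 * m)
2^-mod6 zero = inj₁ (0 , refl)
2^-mod6 (suc j) with 2^-mod6 j
... | inj₁ (m , eq) = inj₂ (2 * m , 2*2mod6 m eq)
... | inj₂ (m , eq) = inj₁ (1 + 2 * m , 2*4mod6 m eq)

-- Room for two consecutive powers: t = 2^(j+1) and 2t are both below n, and te and 2te lie in [n,
-- 4n). One of the two powers is 2 and the other 4 mod 6.
Window : ℕ → ℕ → Set
Window n e = ∃ λ j → 2 ^ suc (suc j) < n × n ≤ 2 ^ suc j * e × 2 ^ suc j * e < 2 * n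

-- The bound e > 3 pays for the second power: 4 · 2^j ≤ 2^j e < n.
doubling-window : ∀ {n e} → 3 < e → e < n → Window n e
doubling-window {n} {e} 3<e e<n with doubling (≤-trans z<s 3<e) e<n
... | j , below , above = j ,
  ≤-<-trans (≤-trans (≤-reflexive (lemma (2 ^ j))) (*-monoʳ-≤ (2 ^ j) 3<e)) below ,
  above , subst (_< 2 * n) (sym (*-assoc 2 (2 ^ j) e)) (*-monoʳ-< 2 below)
  where
  lemma : ∀ p → 2 * (2 * p) ≡ p * 4
  lemma p = solve (p ∷ [])

-- With 3g = 2n ± e and t = 2^j one has 3gt = 2nt ± te, and t alternates between 2 and 4 mod 6, so
-- once te exceeds n the residue gt + n falls into the wrong half for one of the two parities of j.
F-above-2n/3 : ∀ {n g e} m → 3 * g ≡ 2 * n + e → n ≤ (4 + 6 * m) * e → (4 + 6 * m) * e < 4 * n →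
  F (2 * n) (g * (4 + 6 * m) + n) ≡ false
F-above-2n/3 {n} {g} {e} m eq lower upper = trans (F-eval {2 * n} {g * t + n} (2 * m + 2)
    (*-cancelˡ-≤ 3 (≤-trans (by-linear 0 lower (lemma₁ (t * e))) (≤-reflexive (sym thrice))))
    (*-cancelˡ-< 3 _ _ (≤-<-trans (≤-reflexive thrice) (by-linear (3 * n) upper (lemma₂ (t * e))))))
    (trans (odd-+ (2 * m) 2) (cong (_xor false) (odd-* 2 m)))
  where
  t = 4 + 6 * m
  thrice : 3 * (g * t + n) ≡ (11 * n + 12 * m * n) + t * e
  thrice = trans (lemma₃ g) (trans (cong (λ x → x * t + 3 * n) eq) lemma₄)
    where
    lemma₃ : ∀ g → 3 * (g * (4 + 6 * m) + n) ≡ 3 * g * (4 + 6 * m) + 3 * n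
    lemma₃ g = solve (g ∷ m ∷ n ∷ [])
    lemma₄ : (2 * n + e) * (4 + 6 * m) + 3 * n ≡ (11 * n + 12 * m * n) + (4 + 6 * m) * e
    lemma₄ = solve (n ∷ e ∷ m ∷ [])
  lemma₁ : ∀ x → 3 * ((2 * m + 2) * (2 * n)) + 0 + x ≡ n + ((11 * n + 12 * m * n) + x)
  lemma₁ x = solve (n ∷ m ∷ x ∷ [])
  lemma₂ : ∀ x → suc ((11 * n + 12 * m * n) + x) + 3 * n + 4 * n ≡ suc x + 3 * (suc (2 * m + 2) * (2 * n))
  lemma₂ x = solve (n ∷ m ∷ x ∷ [])

F-below-2n/3 : ∀ {n g e} m → 3 * g + e ≡ 2 * n → n < (2 + 6 * m) * e → (2 + 6 * m) * e < 4 * n →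
  F (2 * n) (g * (2 + 6 * m) + n) ≡ false
-- Three times the argument is (12m + 7)n - te, and n < te < 4n puts this between 12mn and (12m +
-- 6)n, whence the even quotient `2 * m`.
F-below-2n/3 {n} {g} {e} m eq lower upper = trans (F-eval {2 * n} {g * t + n} (2 * m)
    (*-cancelˡ-≤ 3 (+-cancelʳ-≤ (t * e) _ _
        (≤-trans (by-linear (1 + 3 * n) upper (lemma₁ (t * e))) (≤-reflexive (sym thrice)))))
    (*-cancelˡ-< 3 _ _ (+-cancelʳ-< (t * e) _ _
        (≤-<-trans (≤-reflexive thrice) (by-linear 0 lower (lemma₂ (t * e)))))))
    (odd-* 2 m)
  where
  t = 2 + 6 * m
  thrice : 3 * (g * t + n) + t * e ≡ 7 * n + 12 * m * n
  thrice = trans (lemma₃ g) (trans (cong (λ x → x * t + 3 * n) eq) lemma₄)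
    where
    lemma₃ : ∀ g → 3 * (g * (2 + 6 * m) + n) + (2 + 6 * m) * e ≡ (3 * g + e) * (2 + 6 * m) + 3 * n
    lemma₃ g = solve (g ∷ m ∷ n ∷ e ∷ [])
    lemma₄ : 2 * n * (2 + 6 * m) + 3 * n ≡ 7 * n + 12 * m * n
    lemma₄ = solve (n ∷ m ∷ [])
  lemma₁ : ∀ x → 3 * (2 * m * (2 * n)) + x + (1 + 3 * n) + 4 * n ≡ suc x + (7 * n + 12 * m * n)
  lemma₁ x = solve (n ∷ m ∷ x ∷ [])
  lemma₂ : ∀ x → suc (7 * n + 12 * m * n) + 0 + x ≡ suc n + (3 * (suc (2 * m) * (2 * n)) + x)
  lemma₂ x = solve (n ∷ m ∷ x ∷ [])

module SmallPreserver3mod4 {n a} (on : odd n ≡ true) (g≤n : 3 + 4 * a ≤ n)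
    (pres : Preserves (2 * n) (3 + 4 * a)) where

  g = 3 + 4 * a

  0<n : 0 < n
  0<n = odd⇒pos {n} on

  -- Now gn ≡ n + 2n mod 4n, so the image of the low unit t + n is gt + n moved by N: the extra flip
  -- makes gt + n high.
  high : ∀ j → 2 ^ suc j < n → F (2 * n) (g * 2 ^ suc j + n) ≡ true
  high j t<n = begin
    F (2 * n) (g * t + n)                                     ≡⟨ not-involutive _ ⟨
    not (not (F (2 * n) (g * t + n)))                         ≡⟨ cong
        (λ b → not (b xor F (2 * n) (g * t + n))) (odd-1+2* a) ⟨
    not (odd (1 + 2 * a) xor F (2 * n) (g * t + n))           ≡⟨ cong not
        (F-shift {2 * n} (g * t + n) (1 + 2 * a) (2*-pos 0<n)) ⟨
    not (F (2 * n) (g * t + n + (1 + 2 * a) * (2 * n)))       ≡⟨ cong (λ x → not (F (2 * n) x)) (lemma t) ⟩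
    not (F (2 * n) (g * (t + n)))                             ≡⟨ cong not (pres (t + n) (coprime-2^+odd j on)) ⟩
    not (F (2 * n) (t + n))                                   ≡⟨ cong not
        (F-low {2 * n} {t + n} (by-linear 0 t<n (lemma′ t))) ⟩
    true                                                      ∎
    where
    open ≡-Reasoning
    t = 2 ^ suc j
    lemma : ∀ t → (3 + 4 * a) * t + n + (1 + 2 * a) * (2 * n) ≡ (3 + 4 * a) * (t + n)
    lemma t = solve (a ∷ t ∷ n ∷ [])
    lemma′ : ∀ t → suc (t + n) + 0 + n ≡ suc t + 2 * n
    lemma′ t = solve (t ∷ n ∷ [])

  not-high : ∀ {t} j → 2 ^ suc j ≡ t → t < n → F (2 * n) (g * t + n) ≡ false → ⊥
  not-high j refl t<n low = contradiction (trans (sym (high j t<n)) low) λ ()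

  -- The powers 2 and, in the next lemma, 4 give crude bounds on g; they yield e < n on either side
  -- of 2n/3, which the doubling of e requires.
  n<2g : n < 2 * g
  n<2g = ≤∧≢⇒< (≮⇒≥ λ 2g<n → not-high 0 refl (≤-trans (m≤m+n 3 (4 * a)) g≤n)
      (F-low {2 * n} {g * 2 + n} (by-linear 0 2g<n lemma)))
      λ n≡2g → contradiction (trans (sym on) (trans (cong odd n≡2g) (odd-* 2 g))) λ ()
    where
    lemma : suc ((3 + 4 * a) * 2 + n) + 0 + n ≡ suc (2 * (3 + 4 * a)) + 2 * n
    lemma = solve (a ∷ n ∷ [])

  4g<3n : 4 < n → 4 * g < 3 * n
  4g<3n 4<n = ≰⇒> λ 3n≤4g → not-high 1 refl 4<n (F-eval {2 * n} {g * 4 + n} 2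
      (by-linear 0 3n≤4g lemma) (by-linear 0 (+-mono-≤ 0<n (scale-≤ 4 g≤n)) lemma′))
    where
    lemma : 2 * (2 * n) + 0 + 4 * (3 + 4 * a) ≡ 3 * n + ((3 + 4 * a) * 4 + n)
    lemma = solve (a ∷ n ∷ [])
    lemma′ : suc ((3 + 4 * a) * 4 + n) + 0 + (n + 4 * n) ≡ 1 + 4 * (3 + 4 * a) + 3 * (2 * n)
    lemma′ = solve (a ∷ n ∷ [])

  -- For e > 3 the window contains a power that is 4 mod 6, and there `F-above-2n/3` contradicts
  -- `high`.
  excess≤3 : ∀ {e} → 3 * g ≡ 2 * n + e → e ≤ 3
  excess≤3 {e} eq = ≮⇒≥ λ 3<e → conclude (doubling-window 3<e (e<n 3<e))
    where
    e≤n : e ≤ n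
    e≤n = by-linear 0 (scale-≤ 3 g≤n) (lemma (3 * g) eq)
      where
      lemma : ∀ x → x ≡ 2 * n + e → e + 0 + 3 * n ≡ x + n
      lemma _ refl = solve (e ∷ n ∷ [])
    4<n : 3 < e → 4 < n
    4<n 3<e = ≤∧≢⇒< (≤-trans 3<e e≤n) λ { refl → contradiction on λ () }
    e<n : 3 < e → e < n
    e<n 3<e = by-linear (2 + 3 * e) (scale-≤ 3 (4g<3n (4<n 3<e))) (trans (lemma (3 * g) eq) (lemma′ g))
      where
      lemma : ∀ x → x ≡ 2 * n + e → suc e + (2 + 3 * e) + 3 * (3 * n) ≡ 3 + 4 * x + n
      lemma _ refl = solve (e ∷ n ∷ [])
      lemma′ : ∀ g → 3 + 4 * (3 * g) + n ≡ 3 * suc (4 * g) + n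
      lemma′ g = solve (g ∷ n ∷ [])
    excluded : ∀ j {m} → 2 ^ suc j ≡ 4 + 6 * m → 2 ^ suc j < n → n ≤ 2 ^ suc j * e → 2 ^ suc j * e < 4 * n → ⊥
    excluded j {m} eq₄ t<n lower upper = not-high j eq₄ (subst (_< n) eq₄ t<n)
      (F-above-2n/3 {n} {g} m eq (subst (λ t → n ≤ t * e) eq₄ lower) (subst (λ t → t * e < 4 * n) eq₄ upper))
    conclude : Window n e → ⊥
    conclude (j , 2t<n , n≤te , te<2n) with 2^-mod6 j
    ... | inj₂ (m , eq₄) = excluded j {m} eq₄ (≤-<-trans (m≤m+n _ _) 2t<n) n≤te
            (<-≤-trans te<2n (*-monoˡ-≤ n (m≤m+n 2 2)))
    ... | inj₁ (m , eq₂) = excluded (suc j) {2 * m} (2*2mod6 m eq₂) 2t<n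
            (≤-trans n≤te (*-monoˡ-≤ e {2 ^ suc j} {2 ^ suc (suc j)} (m≤m+n _ _)))
            (by-linear 1 (scale-≤ 2 te<2n) (lemma (2 ^ suc j)))
      where
      lemma : ∀ t → suc (2 * t * e) + 1 + 2 * (2 * n) ≡ 2 * suc (t * e) + 4 * n
      lemma t = solve (t ∷ e ∷ n ∷ [])

  -- The mirror image of `excess≤3`, with the power that is 2 mod 6. If it is the first power of the
  -- window, n < te is strict because te is even and n odd.
  defect≤3 : ∀ {e} → 3 * g + e ≡ 2 * n → e ≤ 3
  defect≤3 {e} eq = ≮⇒≥ λ 3<e → conclude (doubling-window 3<e e<n)
    where
    e<n : e < n
    e<n = by-linear (2 + e) (scale-≤ 3 n<2g) (trans (lemma g) (trans (cong (λ x → 3 + 2 * x) eq) lemma′))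
      where
      lemma : ∀ g → suc e + (2 + e) + 3 * (2 * g) ≡ 3 + 2 * (3 * g + e)
      lemma g = solve (e ∷ g ∷ [])
      lemma′ : 3 + 2 * (2 * n) ≡ 3 * suc n + n
      lemma′ = solve (n ∷ [])
    excluded : ∀ j {m} → 2 ^ suc j ≡ 2 + 6 * m → 2 ^ suc j < n → n < 2 ^ suc j * e → 2 ^ suc j * e < 4 * n → ⊥
    excluded j {m} eq₂ t<n lower upper = not-high j eq₂ (subst (_< n) eq₂ t<n)
      (F-below-2n/3 {n} {g} m eq (subst (λ t → n < t * e) eq₂ lower) (subst (λ t → t * e < 4 * n) eq₂ upper))
    conclude : Window n e → ⊥
    conclude (j , 2t<n , n≤te , te<2n) with 2^-mod6 j
    ... | inj₁ (m , eq₂) = excluded j {m} eq₂ (≤-<-trans (m≤m+n _ _) 2t<n)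
            (≤∧≢⇒< n≤te λ n≡te → contradiction (trans (sym on) (trans (cong odd n≡te)
              (trans (odd-* (2 ^ suc j) e) (cong (_∧ odd e) (odd-* 2 (2 ^ j)))))) λ ())
            (<-≤-trans te<2n (*-monoˡ-≤ n (m≤m+n 2 2)))
    ... | inj₂ (m , eq₄) = excluded (suc j) {1 + 2 * m} (2*4mod6 m eq₄) 2t<n
            (by-linear 0 (+-mono-≤ 0<n (scale-≤ 2 n≤te)) (lemma (2 ^ suc j)))
            (by-linear 1 (scale-≤ 2 te<2n) (lemma′ (2 ^ suc j)))
      where
      lemma : ∀ t → suc n + 0 + (n + 2 * (t * e)) ≡ 1 + 2 * n + 2 * t * e
      lemma t = solve (t ∷ e ∷ n ∷ [])
      lemma′ : ∀ t → suc (2 * t * e) + 1 + 2 * (2 * n) ≡ 2 * suc (t * e) + 4 * n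
      lemma′ t = solve (t ∷ e ∷ n ∷ [])

-- The multipliers next to 2n/3.

-- The congruence g² ≡ 1 mod d, kept free of subtraction.
Involution : ℕ → ℕ → Set
Involution d g = ∃₂ λ K L → g * g + L * d ≡ 1 + K * d

parity-≢ : ∀ {x y} → odd x ≡ false → odd y ≡ true → x ≢ y
parity-≢ ex oy refl = contradiction (trans (sym ex) oy) λ ()

-- With w = 1 + 2a one has g = 2w + 1, d = 12w and g² - 1 = 8w(1 + a). The involution therefore
-- forces 3 to divide 1 + a, that is, w ≡ 5 mod 6.
no-preserver-12[1+2a] : ∀ a K L → Preserves (2 * (3 * (1 + 2 * a))) (3 + 4 * a) →
  (3 + 4 * a) * (3 + 4 * a) + L * (4 * (3 * (1 + 2 * a))) ≡ 1 + K * (4 * (3 * (1 + 2 * a))) → a ≡ 2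
no-preserver-12[1+2a] a K L pres inv = go (3∣1+a) pres
  where
  reduced : 2 * (1 + a) + 3 * L ≡ 3 * K
  reduced = *-cancelˡ-≡ _ _ (4 * (1 + 2 * a)) (suc-injective (trans lemma₁ (trans inv lemma₂)))
    where
    lemma₁ : suc (4 * (1 + 2 * a) * (2 * (1 + a) + 3 * L)) ≡ (3 + 4 * a) * (3 + 4 * a) + L * (4 * (3 * (1 + 2 * a)))
    lemma₁ = solve (a ∷ L ∷ [])
    lemma₂ : 1 + K * (4 * (3 * (1 + 2 * a))) ≡ suc (4 * (1 + 2 * a) * (3 * K))
    lemma₂ = solve (a ∷ K ∷ [])
  3∣1+a : 3 ∣ 1 + a
  3∣1+a = coprime-divisor (gcd≡1⇒coprime {3} {2} refl) 3∣2[1+a]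
    where
    3∣2[1+a] : 3 ∣ 2 * (1 + a)
    3∣2[1+a] = ∣m+n∣m⇒∣n (subst (3 ∣_) (trans (sym reduced) (+-comm (2 * (1 + a)) (3 * L))) (m∣m*n K)) (m∣m*n L)
  go : ∀ {a} → 3 ∣ 1 + a → Preserves (2 * (3 * (1 + 2 * a))) (3 + 4 * a) → a ≡ 2
  go (divides 0 ()) _
  go (divides 1 refl) _ = refl
  -- The unit is 5w + 6 with w = 11 + 6c, prime to 2, 3 and w. It is low as soon as w > 6, which
  -- spares w = 5, and its image is 7w + 6, between 6w and 12w.
  go (divides (suc (suc c)) refl) pres = ⊥-elim (not-preserves {2 * (3 * (1 + 2 * (5 + c * 3)))} {3 + 4 * (5 + c * 3)}
      (61 + 30 * c) (10 + 5 * c) (83 + 42 * c)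
      (coprime-2* {61 + 30 * c} {2 * (3 * (1 + 2 * (5 + c * 3)))} odd-u
          (coprime-2* {61 + 30 * c} {3 * (1 + 2 * (5 + c * 3))} odd-u (coprime-*ʳ coprime-3 coprime-N)))
      (by-linear (4 + 6 * c) (z≤n {0}) (solve (c ∷ [])))
      (by-linear (17 + 6 * c) (z≤n {0}) (solve (c ∷ [])))
      (by-linear (48 + 30 * c) (z≤n {0}) (solve (c ∷ [])))
      product pres)
    where
    odd-u : odd (61 + 30 * c) ≡ true
    odd-u = trans (odd-+ 61 (30 * c)) (cong not (odd-* 30 c))
    coprime-3 : Coprime (61 + 30 * c) 3
    coprime-3 = subst (λ x → Coprime x 3) lemma (coprime-+* (20 + 10 * c) (1-coprimeTo 3))
      where
      lemma : 1 + (20 + 10 * c) * 3 ≡ 61 + 30 * c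
      lemma = solve (c ∷ [])
    coprime-N : Coprime (61 + 30 * c) (1 + 2 * (5 + c * 3))
    coprime-N = subst₂ Coprime lemma₁ lemma₂
      (coprime-+* 5 (coprime-sym (coprime-+* (1 + c) (gcd≡1⇒coprime {5} {6} refl))))
      where
      lemma₁ : 6 + 5 * (5 + (1 + c) * 6) ≡ 61 + 30 * c
      lemma₁ = solve (c ∷ [])
      lemma₂ : 5 + (1 + c) * 6 ≡ 1 + 2 * (5 + c * 3)
      lemma₂ = solve (c ∷ [])
    product : (3 + 4 * (5 + c * 3)) * (61 + 30 * c) ≡
        83 + 42 * c + (10 + 5 * c) * (2 * (2 * (3 * (1 + 2 * (5 + c * 3)))))
    product = solve (c ∷ [])

-- Here 3g = 2n - 1, so 9 ≡ 9g² ≡ 1 mod n and n divides 8, impossible for an odd n ≥ 5.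
n≢5+6a : ∀ a K L → (3 + 4 * a) * (3 + 4 * a) + L * (4 * (5 + 6 * a)) ≡ 1 + K * (4 * (5 + 6 * a)) → ⊥
n≢5+6a a K L inv = contradiction (coprime-8 (∣-refl , n∣8)) λ ()
  where
  n = 5 + 6 * a
  odd-n : odd n ≡ true
  odd-n = trans (odd-+ 5 (6 * a)) (cong not (odd-* 6 a))
  coprime-8 : Coprime n 8
  coprime-8 = coprime-2* {n} {4} odd-n (coprime-2* {n} {2} odd-n (odd⇒coprime-2 odd-n))
  identity : (5 + 6 * a) * (4 + 36 * K) + 8 ≡ (5 + 6 * a) * (4 * (5 + 6 * a) + 36 * L)
  identity = suc-injective (trans lemma₁ (trans (cong (λ x → 9 * x + 4 * (5 + 6 * a)) (sym inv)) lemma₂))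
    where
    lemma₁ : suc ((5 + 6 * a) * (4 + 36 * K) + 8) ≡ 9 * (1 + K * (4 * (5 + 6 * a))) + 4 * (5 + 6 * a)
    lemma₁ = solve (a ∷ K ∷ [])
    lemma₂ : 9 * ((3 + 4 * a) * (3 + 4 * a) + L * (4 * (5 + 6 * a))) + 4 * (5 + 6 * a) ≡
        suc ((5 + 6 * a) * (4 * (5 + 6 * a) + 36 * L))
    lemma₂ = solve (a ∷ L ∷ [])
  n∣8 : n ∣ 8
  n∣8 = ∣m+n∣m⇒∣n (subst (n ∣_) (sym identity) (m∣m*n {n} (4 * n + 36 * L))) (m∣m*n {n} (4 + 36 * K))

odd-3[3+4a] : ∀ a → odd (3 * (3 + 4 * a)) ≡ true
odd-3[3+4a] a = trans (odd-* 3 (3 + 4 * a)) (cong (λ b → not (not (not b))) (odd-* 4 a))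

-- Modulo 4, 3g is 1 and 2n is 2, which leaves e = 3; in the same way the defect below can only be
-- 1.
excess⇒n≡3[1+2a] : ∀ {n} a e → odd n ≡ true → e ≤ 3 → 2 * n + e ≡ 3 * (3 + 4 * a) → n ≡ 3 * (1 + 2 * a)
excess⇒n≡3[1+2a] {n} a 0 on _ eq =
  contradiction eq (parity-≢ (trans (odd-+ (2 * n) 0) (cong (_xor false) (odd-* 2 n))) (odd-3[3+4a] a))
excess⇒n≡3[1+2a] {n} a 1 on _ eq =
  contradiction (*-cancelˡ-≡ (2 * (2 + 3 * a)) n 2 (suc-injective (trans lemma (trans (sym eq) (+-comm (2 * n) 1)))))
    (parity-≢ (odd-* 2 (2 + 3 * a)) on)
  where
  lemma : suc (2 * (2 * (2 + 3 * a))) ≡ 3 * (3 + 4 * a)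
  lemma = solve (a ∷ [])
excess⇒n≡3[1+2a] {n} a 2 on _ eq =
  contradiction eq (parity-≢ (trans (odd-+ (2 * n) 2) (cong (_xor false) (odd-* 2 n))) (odd-3[3+4a] a))
excess⇒n≡3[1+2a] {n} a 3 on _ eq =
  *-cancelˡ-≡ n (3 * (1 + 2 * a)) 2 (+-cancelʳ-≡ 3 (2 * n) (2 * (3 * (1 + 2 * a))) (trans eq lemma))
  where
  lemma : 3 * (3 + 4 * a) ≡ 2 * (3 * (1 + 2 * a)) + 3
  lemma = solve (a ∷ [])
excess⇒n≡3[1+2a] a (suc (suc (suc (suc _)))) on (s≤s (s≤s (s≤s ()))) _

defect⇒n≡5+6a : ∀ {n} a e → odd n ≡ true → e ≤ 3 → 3 * (3 + 4 * a) + e ≡ 2 * n → n ≡ 5 + 6 * a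
defect⇒n≡5+6a {n} a 0 on _ eq =
  contradiction (sym eq) (parity-≢ (odd-* 2 n)
      (trans (odd-+ (3 * (3 + 4 * a)) 0) (cong (_xor false) (odd-3[3+4a] a))))
defect⇒n≡5+6a {n} a 1 on _ eq = *-cancelˡ-≡ n (5 + 6 * a) 2 (trans (sym eq) lemma)
  where
  lemma : 3 * (3 + 4 * a) + 1 ≡ 2 * (5 + 6 * a)
  lemma = solve (a ∷ [])
defect⇒n≡5+6a {n} a 2 on _ eq =
  contradiction (sym eq) (parity-≢ (odd-* 2 n)
      (trans (odd-+ (3 * (3 + 4 * a)) 2) (cong (_xor false) (odd-3[3+4a] a))))
defect⇒n≡5+6a {n} a 3 on _ eq =
  contradiction (*-cancelˡ-≡ (2 * (3 + 3 * a)) n 2 (trans lemma eq)) (parity-≢ (odd-* 2 (3 + 3 * a)) on)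
  where
  lemma : 2 * (2 * (3 + 3 * a)) ≡ 3 * (3 + 4 * a) + 3
  lemma = solve (a ∷ [])
defect⇒n≡5+6a a (suc (suc (suc (suc _)))) on (s≤s (s≤s (s≤s ()))) _

small-preserver-3mod4 : ∀ {n} a → odd n ≡ true → 3 + 4 * a ≤ n → Preserves (2 * n) (3 + 4 * a) →
  Involution (4 * n) (3 + 4 * a) → n ≡ 15 × a ≡ 2
small-preserver-3mod4 {n} a on g≤n pres (K , L , inv) with ≤-total (2 * n) (3 * (3 + 4 * a))
... | inj₁ 2n≤3g = finish {n} (excess⇒n≡3[1+2a] {n} a (proj₁ e) on (excess≤3 (sym (proj₂ e))) (proj₂ e)) pres inv
  where
  open SmallPreserver3mod4 {n} {a} on g≤n pres using (excess≤3)
  e : ∃ λ e → 2 * n + e ≡ 3 * (3 + 4 * a)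
  e = m≤n⇒∃[o]m+o≡n 2n≤3g
  finish : ∀ {n} → n ≡ 3 * (1 + 2 * a) → Preserves (2 * n) (3 + 4 * a) →
    (3 + 4 * a) * (3 + 4 * a) + L * (4 * n) ≡ 1 + K * (4 * n) → n ≡ 15 × a ≡ 2
  finish refl pres inv = cong (λ x → 3 * (1 + 2 * x)) a≡2 , a≡2
    where a≡2 = no-preserver-12[1+2a] a K L pres inv
... | inj₂ 3g≤2n = ⊥-elim (n≢5+6a a K L (subst (λ n → (3 + 4 * a) * (3 + 4 * a) + L * (4 * n) ≡ 1 + K * (4 * n))
      (defect⇒n≡5+6a {n} a (proj₁ e) on (defect≤3 (proj₂ e)) (proj₂ e)) inv))
  where
  open SmallPreserver3mod4 {n} {a} on g≤n pres using (defect≤3)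
  e : ∃ λ e → 3 * (3 + 4 * a) + e ≡ 2 * n
  e = m≤n⇒∃[o]m+o≡n 3g≤2n

-- Reflection reduces to g ≤ n, since it keeps 3 mod 4 for odd n. At n = 15 it pairs g = 11 with g =
-- 19, that is, a = 2 with a = 4.
preserver-3mod4 : ∀ {n} a → odd n ≡ true → 3 + 4 * a < 2 * (2 * n) → Preserves (2 * n) (3 + 4 * a) →
  Involution (4 * n) (3 + 4 * a) → n ≡ 15 × (a ≡ 2 ⊎ a ≡ 4)
preserver-3mod4 {n} a on g<4n pres (K , L , inv) with odd⇒1+2* n on
... | b , refl with ≤-total (3 + 4 * a) n
...   | inj₁ g≤n with small-preserver-3mod4 {1 + 2 * b} a on g≤n pres (K , L , inv)
...     | n≡15 , a≡2 = n≡15 , inj₁ a≡2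
preserver-3mod4 {n} a on g<4n pres (K , L , inv) | b , refl | inj₂ n≤g with m≤n⇒∃[o]m+o≡n a<b
  where
  g<2n : 3 + 4 * a < 2 * (1 + 2 * b)
  g<2n = low⇒< {2 * (1 + 2 * b)} {3 + 4 * a}
      (preserves⇒low {2 * (1 + 2 * b)} {3 + 4 * a} (*-monoʳ-≤ 2 (s≤s z≤n)) pres) g<4n
  a<b : a < b
  a<b = *-cancelˡ-< 4 a b (by-linear 1 g<2n (lemma a))
    where
    lemma : ∀ a → suc (4 * a) + 1 + 2 * (1 + 2 * b) ≡ suc (3 + 4 * a) + 4 * b
    lemma a = solve (a ∷ b ∷ [])
... | c , refl = finish (small-preserver-3mod4 {1 + 2 * (suc a + c)} c on
      (by-linear 0 n≤g (lemma₁ a c))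
      (preserves-reflect {1 + 2 * (suc a + c)} {3 + 4 * a} {3 + 4 * c} (odd-3+4* a) (lemma₂ a c) pres)
      -- The witnesses come from (2n - g)² - g² = 4n(2c - 2a).
      (K + 2 * c , L + 2 * a , reflected))
  where
  odd-3+4* : ∀ a → odd (3 + 4 * a) ≡ true
  odd-3+4* a = cong (λ b → not (not (not b))) (odd-* 4 a)
  lemma₁ : ∀ a c → 3 + 4 * c + 0 + (3 + 4 * a) ≡ 1 + 2 * (suc a + c) + (1 + 2 * (suc a + c))
  lemma₁ a c = solve (a ∷ c ∷ [])
  lemma₂ : ∀ a c → 3 + 4 * a + (3 + 4 * c) ≡ 2 * (1 + 2 * (suc a + c))
  lemma₂ a c = solve (a ∷ c ∷ [])
  reflected : (3 + 4 * c) * (3 + 4 * c) + (L + 2 * a) * (4 * (1 + 2 * (suc a + c))) ≡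
      1 + (K + 2 * c) * (4 * (1 + 2 * (suc a + c)))
  reflected = trans lemma₃ (trans (cong (_+ 2 * c * (4 * (1 + 2 * (suc a + c)))) inv) lemma₄)
    where
    lemma₃ : (3 + 4 * c) * (3 + 4 * c) + (L + 2 * a) * (4 * (1 + 2 * (suc a + c))) ≡
        (3 + 4 * a) * (3 + 4 * a) + L * (4 * (1 + 2 * (suc a + c))) + 2 * c * (4 * (1 + 2 * (suc a + c)))
    lemma₃ = solve (a ∷ c ∷ L ∷ [])
    lemma₄ : 1 + K * (4 * (1 + 2 * (suc a + c))) + 2 * c * (4 * (1 + 2 * (suc a + c))) ≡
        1 + (K + 2 * c) * (4 * (1 + 2 * (suc a + c)))
    lemma₄ = solve (a ∷ c ∷ K ∷ [])
  finish : 1 + 2 * (suc a + c) ≡ 15 × c ≡ 2 → 1 + 2 * (suc a + c) ≡ 15 × (a ≡ 2 ⊎ a ≡ 4)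
  finish (eq , refl) = eq , inj₂ (+-cancelʳ-≡ 2 a 4 (suc-injective (*-cancelˡ-≡ (suc a + 2) 7 2 (suc-injective eq))))

-- From balanced subgroups to multipliers that swap the halves.

mod-decompose : ∀ {d} x → 0 < d → ∃ λ q → x ≡ x mod d + q * d
mod-decompose {suc d} x _ = x / suc d , m≡m%n+[m/n]*n x (suc d)

mod-< : ∀ {d} x → 0 < d → x mod d < d
mod-< {suc d} x _ = m%n<n x (suc d)

mod-unique : ∀ {d r} q → r < d → (r + q * d) mod d ≡ r
mod-unique {suc d} {r} q r<d = trans ([m+kn]%n≡m%n r q (suc d)) (m<n⇒m%n≡m r<d)

<⇒mod≡ : ∀ {d x} → x < d → x mod d ≡ x
<⇒mod≡ {d} {x} x<d = trans (cong (_mod d) (sym (+-identityʳ x))) (mod-unique 0 x<d)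

T-ext : ∀ {a b} → (T a → T b) → (T b → T a) → a ≡ b
T-ext {true}  {true}  _ _ = refl
T-ext {true}  {false} f _ = ⊥-elim (f _)
T-ext {false} {true}  _ g = ⊥-elim (g _)
T-ext {false} {false} _ _ = refl

isUnit⇒coprime : ∀ {d u} → isUnit d u ≡ true → Coprime u d
isUnit⇒coprime {d} {u} e = gcd≡1⇒coprime (≡ᵇ⇒≡ _ 1 (Equivalence.from T-≡ e))

coprime⇒isUnit : ∀ {d u} → Coprime u d → isUnit d u ≡ true
coprime⇒isUnit {d} {u} c = Equivalence.to T-≡ (≡⇒≡ᵇ _ 1 (coprime⇒gcd≡1 c))

coprime-+*⁻ : ∀ {v n} k → Coprime (v + k * n) n → Coprime v n
coprime-+*⁻ k c (e∣v , e∣n) = c (∣m∣n⇒∣m+n e∣v (∣n⇒∣m*n k e∣n) , e∣n)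

coprime-*ˡ : ∀ {a b n} → Coprime a n → Coprime b n → Coprime (a * b) n
coprime-*ˡ a⊥n b⊥n = coprime-sym (coprime-*ʳ (coprime-sym a⊥n) (coprime-sym b⊥n))

toℕ : Bool → ℕ
toℕ true  = 1
toℕ false = 0

count : (ℕ → Bool) → (ℕ → Bool) → ℕ → ℕ
count A C n = length (filterᵇ A (filterᵇ C (upTo n)))

count-suc : ∀ A C n → count A C (suc n) ≡ count A C n + toℕ (C n ∧ A n)
count-suc A C n = begin
  length (filterᵇ A (filterᵇ C (upTo (suc n))))
    ≡⟨ cong (λ xs → length (filterᵇ A (filterᵇ C xs))) (upTo-∷ʳ n) ⟨
  length (filterᵇ A (filterᵇ C (upTo n ++ n ∷ [])))
    ≡⟨ cong (λ xs → length (filterᵇ A xs)) (filter-++ (T? ∘ C) (upTo n) (n ∷ [])) ⟩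
  length (filterᵇ A (filterᵇ C (upTo n) ++ filterᵇ C (n ∷ [])))
    ≡⟨ cong length (filter-++ (T? ∘ A) (filterᵇ C (upTo n)) (filterᵇ C (n ∷ []))) ⟩
  length (filterᵇ A (filterᵇ C (upTo n)) ++ filterᵇ A (filterᵇ C (n ∷ [])))
    ≡⟨ length-++ (filterᵇ A (filterᵇ C (upTo n))) ⟩
  count A C n + length (filterᵇ A (filterᵇ C (n ∷ [])))
    ≡⟨ cong (count A C n +_) singleton ⟩
  count A C n + toℕ (C n ∧ A n) ∎
  where
  open ≡-Reasoning
  singleton : length (filterᵇ A (filterᵇ C (n ∷ []))) ≡ toℕ (C n ∧ A n)
  singleton with C n
  ... | false = refl
  ... | true with A n
  ...   | false = refl
  ...   | true = refl

single : (ℕ → Bool) → ℕ → ℕ → ℕ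
single A u n = toℕ (does (u <? n) ∧ A u)

single-suc : ∀ A u n → single A u (suc n) ≡ single A u n + toℕ (does (n ≟ u) ∧ A n)
single-suc A u n with <-cmp u n
... | tri< u<n u≢n _ rewrite dec-true (u <? suc n) (m<n⇒m<1+n u<n) | dec-true (u <? n) u<n
                           | dec-false (n ≟ u) (u≢n ∘ sym) = sym (+-identityʳ _)
... | tri≈ u≮n refl _ rewrite dec-true (u <? suc u) (n<1+n u) | dec-false (u <? u) u≮n
                            | dec-true (u ≟ u) refl = refl
... | tri> u≮n u≢n n<u rewrite dec-false (u <? suc n) (λ u<1+n → <⇒≱ n<u (s≤s⁻¹ u<1+n)) | dec-false (u <? n) u≮n
                             | dec-false (n ≟ u) (u≢n ∘ sym) = refl

-- The coset is known only through its membership test along `upTo`, so the count goes by induction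
-- on the range, `single` recording whether u or v has been passed. Distinctness prevents an element
-- from being counted twice.
count-pair : ∀ A C {u v n} → u ≢ v → u < n → v < n → (∀ x → x < n → C x ≡ (x ≡ᵇ u) ∨ (x ≡ᵇ v)) →
  count A C n ≡ toℕ (A u) + toℕ (A v)
count-pair A C {u} {v} {n} u≢v u<n v<n spec = trans (go n ≤-refl)
    (cong₂ (λ s t → toℕ (s ∧ A u) + toℕ (t ∧ A v)) (dec-true (u <? n) u<n) (dec-true (v <? n) v<n))
  where
  disjoint : ∀ x → toℕ (((x ≡ᵇ u) ∨ (x ≡ᵇ v)) ∧ A x) ≡ toℕ ((x ≡ᵇ u) ∧ A x) + toℕ ((x ≡ᵇ v) ∧ A x)
  disjoint x with x ≟ u
  ... | yes refl rewrite dec-true (u ≟ u) refl | dec-false (u ≟ v) u≢v = sym (+-identityʳ _)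
  ... | no x≢u rewrite dec-false (x ≟ u) x≢u = refl
  go : ∀ m → m ≤ n → count A C m ≡ single A u m + single A v m
  go zero    _   = refl
  go (suc m) m<n = begin
    count A C (suc m)
      ≡⟨ count-suc A C m ⟩
    count A C m + toℕ (C m ∧ A m)
      ≡⟨ cong₂ _+_ (go m (<⇒≤ m<n)) (trans (cong (λ c → toℕ (c ∧ A m)) (spec m m<n)) (disjoint m)) ⟩
    single A u m + single A v m + (toℕ ((m ≡ᵇ u) ∧ A m) + toℕ ((m ≡ᵇ v) ∧ A m))
      ≡⟨ interchange (single A u m) (single A v m) _ _ ⟩
    single A u m + toℕ ((m ≡ᵇ u) ∧ A m) + (single A v m + toℕ ((m ≡ᵇ v) ∧ A m))
      ≡⟨ cong₂ _+_ (single-suc A u m) (single-suc A v m) ⟨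
    single A u (suc m) + single A v (suc m) ∎
    where
    open ≡-Reasoning
    interchange : ∀ a b c d → a + b + (c + d) ≡ a + c + (b + d)
    interchange a b c d = solve (a ∷ b ∷ c ∷ d ∷ [])

mod-*-periodic : ∀ {d h} u k → (h * h) mod d ≡ 1 → (u * h ^ suc (suc k)) mod d ≡ (u * h ^ k) mod d
mod-*-periodic {zero} {h} u k hh≡1 = cong (u *_)
    (trans (sym (*-assoc h h (h ^ k))) (trans (cong (_* h ^ k) hh≡1) (*-identityˡ _)))
mod-*-periodic {d@(suc _)} {h} u k hh≡1 with mod-decompose {d} (h * h) z<s
... | q , eq = trans (cong (_% d) expand) ([m+kn]%n≡m%n (u * h ^ k) (u * h ^ k * q) d)
  where
  assoc : ∀ p → u * (h * (h * p)) ≡ u * p * (h * h)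
  assoc p = solve (u ∷ h ∷ p ∷ [])
  distrib : ∀ p → p * (1 + q * d) ≡ p + p * q * d
  distrib p = trans (*-distribˡ-+ p 1 (q * d)) (cong₂ _+_ (*-identityʳ p) (sym (*-assoc p q d)))
  expand : u * h ^ suc (suc k) ≡ u * h ^ k + u * h ^ k * q * d
  expand = trans (assoc (h ^ k)) (trans (cong (u * h ^ k *_) (trans eq (cong (_+ q * d) hh≡1))) (distrib (u * h ^ k)))

mod-*-powers : ∀ {d h} u k → (h * h) mod d ≡ 1 → u < d →
  (u * h ^ k) mod d ≡ u ⊎ (u * h ^ k) mod d ≡ (u * h) mod d
mod-*-powers {d} u 0 _ u<d = inj₁ (trans (cong (_mod d) (*-identityʳ u)) (<⇒mod≡ u<d))
mod-*-powers {d} {h} u 1 _ _ = inj₂ (cong (λ x → (u * x) mod d) (*-identityʳ h))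
mod-*-powers {d} {h} u (suc (suc k)) hh≡1 u<d rewrite mod-*-periodic {d} {h} u k hh≡1 = mod-*-powers u k hh≡1 u<d

-- Since h² ≡ 1, the exponents 0 and 1 represent all powers, and both lie in `upTo d`.
inCoset-pair : ∀ {d h} u x → 2 < d → (h * h) mod d ≡ 1 → u < d →
  inCoset d h u x ≡ (x ≡ᵇ u) ∨ (x ≡ᵇ ((u * h) mod d))
inCoset-pair {d} {h} u x 2<d hh≡1 u<d = T-ext to from
  where
  v = (u * h) mod d
  to : T (inCoset d h u x) → T ((x ≡ᵇ u) ∨ (x ≡ᵇ v))
  to t with applyUpTo⁻ _ (any⁻ _ (upTo d) t)
  ... | k , _ , p with mod-*-powers {d} {h} u k hh≡1 u<d
  ...   | inj₁ e = Equivalence.from T-∨ (inj₁ (subst (λ y → T (x ≡ᵇ y)) e p))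
  ...   | inj₂ e = Equivalence.from T-∨ (inj₂ (subst (λ y → T (x ≡ᵇ y)) e p))
  power : ∀ k → k < d → T (x ≡ᵇ ((u * h ^ k) mod d)) → T (inCoset d h u x)
  power k k<d p = any⁺ (λ k → x ≡ᵇ ((u * h ^ k) mod d)) (applyUpTo⁺ _ p k<d)
  from : T ((x ≡ᵇ u) ∨ (x ≡ᵇ v)) → T (inCoset d h u x)
  from t with Equivalence.to (T-∨ {x ≡ᵇ u}) t
  ... | inj₁ p = power 0 (<-trans z<s 2<d)
          (subst (λ y → T (x ≡ᵇ y)) (sym (trans (cong (_mod d) (*-identityʳ u)) (<⇒mod≡ u<d))) p)
  ... | inj₂ p = power 1 (<-trans (s≤s z<s) 2<d) (subst (λ y → T (x ≡ᵇ ((u * y) mod d))) (sym (*-identityʳ h)) p)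

FlipsBelow : ℕ → ℕ → Set
FlipsBelow d h = ∀ {u} → u < d → isUnit d u ≡ true → (2 * u <ᵇ d) ≡ not (2 * ((u * h) mod d) <ᵇ d)

-- Cancelling the unit u leaves d dividing h - 1, which is smaller than d. This is what makes each
-- coset have two elements.
unit≢*h : ∀ {d h u} → 0 < d → h < d → h ≢ 1 → (h * h) mod d ≡ 1 → u < d → Coprime u d → u ≢ (u * h) mod d
unit≢*h {d} {zero} 0<d h<d h≢1 hh≡1 u<d u⊥d _ = contradiction (trans (sym (<⇒mod≡ {d} {0} 0<d)) hh≡1) λ ()
unit≢*h {d} {h@(suc h′)} {u} 0<d h<d h≢1 hh≡1 u<d u⊥d u≡uh with mod-decompose {d} (u * h) 0<d
... | q , eq with h′ | coprime-divisor {d} {u} {h′} (coprime-sym u⊥d)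
        (divides q (+-cancelˡ-≡ u _ _ (trans (sym (*-suc u h′)) (trans eq (cong (_+ q * d) (sym u≡uh))))))
... | zero   | _ = h≢1 refl
... | suc h″ | d∣h′ = <⇒≱ h<d (≤-trans (∣⇒≤ d∣h′) (n≤1+n _))

balanced⇔flipsBelow : ∀ {d h} → 2 < d → h < d → isUnit d h ≡ true → h ≢ 1 → (h * h) mod d ≡ 1 →
  Balanced d h ⇔ FlipsBelow d h
balanced⇔flipsBelow {d} {h} 2<d h<d unit-h h≢1 hh≡1 = mk⇔
  (λ bal {u} u<d unit-u → to {u} unit-u
    (trans (sym (counts u u<d unit-u (inA d))) (trans (bal u u<d unit-u) (counts u u<d unit-u (inB d)))))
  (λ flips u u<d unit-u →
    trans (counts u u<d unit-u (inA d)) (trans (from {u} unit-u (flips u<d unit-u)) (sym (counts u u<d unit-u (inB d)))))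
  where
  0<d : 0 < d
  0<d = <-trans z<s 2<d
  v : ℕ → ℕ
  v u = (u * h) mod d
  unit-v : ∀ {u} → isUnit d u ≡ true → isUnit d (v u) ≡ true
  unit-v {u} unit-u with mod-decompose {d} (u * h) 0<d
  ... | q , eq = coprime⇒isUnit {d} {v u} (coprime-+*⁻ q
        (subst (λ x → Coprime x d) eq (coprime-*ˡ {u} {h} (isUnit⇒coprime {d} {u} unit-u)
            (isUnit⇒coprime {d} {h} unit-h))))
  counts : ∀ u → u < d → isUnit d u ≡ true → ∀ A → length (filterᵇ A (coset d h u)) ≡ toℕ (A u) + toℕ (A (v u))
  counts u u<d unit-u A = count-pair A (inCoset d h u)
    (unit≢*h {d} {h} {u} 0<d h<d h≢1 hh≡1 u<d (isUnit⇒coprime {d} {u} unit-u)) u<d (mod-< (u * h) 0<d)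
    (λ x _ → inCoset-pair u x 2<d hh≡1 u<d)
  inA-unit : ∀ x → isUnit d x ≡ true → inA d x ≡ (2 * x <ᵇ d)
  inA-unit zero    unit-x = contradiction (isUnit⇒coprime {d} {0} unit-x (d ∣0 , ∣-refl)) λ d≡1 → <⇒≢
      (<-trans (s≤s z<s) 2<d) (sym d≡1)
  inA-unit (suc x) unit-x rewrite unit-x = refl
  inB-unit : ∀ x → isUnit d x ≡ true → inB d x ≡ not (2 * x <ᵇ d)
  inB-unit x unit-x = cong₂ (λ s t → s ∧ not t) unit-x (inA-unit x unit-x)
  boole-to : ∀ a b → toℕ a + toℕ b ≡ toℕ (not a) + toℕ (not b) → a ≡ not b
  boole-to true  false _ = refl
  boole-to false true  _ = refl
  boole-from : ∀ a b → a ≡ not b → toℕ a + toℕ b ≡ toℕ (not a) + toℕ (not b)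
  boole-from _ true  refl = refl
  boole-from _ false refl = refl
  sum-inA : ∀ {u} → isUnit d u ≡ true →
    toℕ (inA d u) + toℕ (inA d (v u)) ≡ toℕ (2 * u <ᵇ d) + toℕ (2 * v u <ᵇ d)
  sum-inA {u} unit-u = cong₂ (λ a b → toℕ a + toℕ b) (inA-unit u unit-u) (inA-unit (v u) (unit-v {u} unit-u))
  sum-inB : ∀ {u} → isUnit d u ≡ true →
    toℕ (inB d u) + toℕ (inB d (v u)) ≡ toℕ (not (2 * u <ᵇ d)) + toℕ (not (2 * v u <ᵇ d))
  sum-inB {u} unit-u = cong₂ (λ a b → toℕ a + toℕ b) (inB-unit u unit-u) (inB-unit (v u) (unit-v {u} unit-u))
  to : ∀ {u} → isUnit d u ≡ true → toℕ (inA d u) + toℕ (inA d (v u)) ≡ toℕ (inB d u) + toℕ (inB d (v u)) →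
    (2 * u <ᵇ d) ≡ not (2 * v u <ᵇ d)
  to {u} unit-u eq = boole-to _ _ (subst₂ _≡_ (sum-inA {u} unit-u) (sum-inB {u} unit-u) eq)
  from : ∀ {u} → isUnit d u ≡ true → (2 * u <ᵇ d) ≡ not (2 * v u <ᵇ d) →
    toℕ (inA d u) + toℕ (inA d (v u)) ≡ toℕ (inB d u) + toℕ (inB d (v u))
  from {u} unit-u eq = subst₂ _≡_ (sym (sum-inA {u} unit-u)) (sym (sum-inB {u} unit-u)) (boole-from _ _ eq)

-- Doubling the argument instead of halving d gives a half indicator that also serves odd d. Ranging
-- over all u prime to d avoids reductions modulo d.
Flips : ℕ → ℕ → Set
Flips d h = ∀ u → Coprime u d → F d (2 * (h * u)) ≡ not (F d (2 * u))

F-2* : ∀ {d x} → x < d → F d (2 * x) ≡ not (2 * x <ᵇ d)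
F-2* {d} {x} x<d with 2 * x <? d
... | yes lt rewrite dec-true (2 * x <? d) lt = F-low lt
... | no ¬lt rewrite dec-false (2 * x <? d) ¬lt = F-high (≮⇒≥ ¬lt) (*-monoʳ-< 2 x<d)

F-2*-shift : ∀ {d} x q → 0 < d → F d (2 * (x + q * d)) ≡ F d (2 * x)
F-2*-shift {d} x q 0<d = trans (cong (F d) lemma) (F-shift-even {d} (2 * x) q 0<d)
  where
  lemma : 2 * (x + q * d) ≡ 2 * x + q * (2 * d)
  lemma = solve (x ∷ q ∷ d ∷ [])

F-2*-mod : ∀ {d} x → 0 < d → F d (2 * x) ≡ not (2 * (x mod d) <ᵇ d)
F-2*-mod {d} x 0<d with mod-decompose {d} x 0<d
... | q , eq = trans (cong (λ y → F d (2 * y)) eq) (trans (F-2*-shift (x mod d) q 0<d) (F-2* (mod-< x 0<d)))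

flipsBelow⇔flips : ∀ {d h} → 0 < d → FlipsBelow d h ⇔ Flips d h
flipsBelow⇔flips {d} {h} 0<d = mk⇔ to from
  where
  to : FlipsBelow d h → Flips d h
  to below u u⊥d with mod-decompose {d} u 0<d
  ... | q , eq = begin
    F d (2 * (h * u))                ≡⟨ cong (λ x → F d (2 * x)) (trans (cong (h *_) eq) (lemma r)) ⟩
    F d (2 * (r * h + h * q * d))    ≡⟨ F-2*-shift (r * h) (h * q) 0<d ⟩
    F d (2 * (r * h))                ≡⟨ F-2*-mod (r * h) 0<d ⟩
    not (2 * ((r * h) mod d) <ᵇ d)   ≡⟨ below r<d
        (coprime⇒isUnit {d} {r} (coprime-+*⁻ q (subst (λ x → Coprime x d) eq u⊥d))) ⟨
    (2 * r <ᵇ d)                     ≡⟨ not-involutive _ ⟨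
    not (not (2 * r <ᵇ d))           ≡⟨ cong not (F-2*-mod u 0<d) ⟨
    not (F d (2 * u))                ∎
    where
    open ≡-Reasoning
    r = u mod d
    r<d : r < d
    r<d = mod-< u 0<d
    lemma : ∀ r → h * (r + q * d) ≡ r * h + h * q * d
    lemma r = solve (h ∷ r ∷ q ∷ d ∷ [])
  from : Flips d h → FlipsBelow d h
  from flips {u} u<d unit-u = begin
    (2 * u <ᵇ d)                           ≡⟨ not-involutive _ ⟨
    not (not (2 * u <ᵇ d))                 ≡⟨ cong not (F-2* u<d) ⟨
    not (F d (2 * u))                      ≡⟨ flips u (isUnit⇒coprime {d} {u} unit-u) ⟨
    F d (2 * (h * u))                      ≡⟨ cong (λ x → F d (2 * x)) (*-comm h u) ⟩
    F d (2 * (u * h))                      ≡⟨ F-2*-mod (u * h) 0<d ⟩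
    not (2 * ((u * h) mod d) <ᵇ d)         ∎
    where open ≡-Reasoning

flips⇒complement-same : ∀ {d h g} → 2 < d → g + h ≡ d → Coprime h d → Flips d h →
  ∀ u → Coprime u d → F d (2 * (g * u)) ≡ F d (2 * u)
flips⇒complement-same {d} {h} {g} 2<d sum h⊥d flips u u⊥d = begin
  F d (2 * (g * u))                               ≡⟨ F-reflect (2 * (h * u)) (2 * (g * u)) (2 * u) d∤2hu sum′ ⟩
  not (odd (2 * u) xor F d (2 * (h * u)))         ≡⟨ cong (λ b → not (b xor F d (2 * (h * u)))) (odd-* 2 u) ⟩
  not (F d (2 * (h * u)))                         ≡⟨ cong not (flips u u⊥d) ⟩
  not (not (F d (2 * u)))                         ≡⟨ not-involutive _ ⟩
  F d (2 * u)                                     ∎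
  where
  open ≡-Reasoning
  d∤2hu : ¬ (d ∣ 2 * (h * u))
  d∤2hu d∣ = <⇒≱ 2<d (∣⇒≤ (coprime-divisor (coprime-sym (coprime-*ˡ {h} {u} h⊥d u⊥d))
    (subst (d ∣_) (*-comm 2 (h * u)) d∣)))
  sum′ : 2 * (h * u) + 2 * (g * u) ≡ 2 * u * d
  sum′ = trans lemma (cong (2 * u *_) sum)
    where
    lemma : 2 * (h * u) + 2 * (g * u) ≡ 2 * u * (g + h)
    lemma = solve (h ∷ g ∷ u ∷ [])

-- Classification of h.

-- Stated for d = 4n, as complements of g: 2n - 1 in general, 7 and 5 modulo 24, 19 and 11 modulo
-- 60.
Order2Cases : ℕ → ℕ → Set
Order2Cases n h = h ≡ 1 + 2 * n ⊎ (n ≡ 6 × (h ≡ 17 ⊎ h ≡ 19)) ⊎ (n ≡ 15 × (h ≡ 41 ⊎ h ≡ 49))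

multiple-small : ∀ {n c} k → c ≡ k * n → c < n → c ≡ 0
multiple-small zero refl _ = refl
multiple-small {n} (suc k) refl c<n = contradiction (m≤m+n n (k * n)) (<⇒≱ c<n)

1+6k<6 : ∀ {c} k → c ≡ 1 + k * 6 → c < 6 → c ≡ 1
1+6k<6 zero    refl _ = refl
1+6k<6 (suc k) refl (s≤s (s≤s (s≤s (s≤s (s≤s (s≤s ()))))))

cases-1mod4 : ∀ {n h} a → 0 < n → a ≢ 0 → 1 + 4 * a + h ≡ 2 * (2 * n) → 1 + 4 * a < 2 * (2 * n) →
  Preserves (2 * n) (1 + 4 * a) → Order2Cases n h
cases-1mod4 {n} {h} a 0<n a≢0 sum g<4n pres with halve n
... | inj₂ (b , refl) with preserver-4odd-1mod4 {1 + 2 * b} a (odd-1+2* b) g<4n pres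
...   | inj₁ a≡0 = contradiction a≡0 a≢0
...   | inj₂ e = inj₁ (+-cancelˡ-≡ (1 + 4 * a) _ _
      (trans sum (trans (lemma (2 * (1 + 2 * b)) e) (sym (+-suc (1 + 4 * a) _)))))
  where
  lemma : ∀ x → suc (1 + 4 * a) ≡ x → 2 * x ≡ suc (1 + 4 * a + x)
  lemma _ refl = solve (a ∷ [])
cases-1mod4 {n} {h} a 0<n a≢0 sum g<4n pres | inj₁ (k , refl) with preserver-1mod4 (2 * k) a 0<n pres
... | inj₁ (j , eq) = contradiction (multiple-small j eq a<n) a≢0
  where
  a<n : a < 2 * k
  a<n = *-cancelˡ-< 4 a (2 * k) (by-linear 1 g<4n lemma)
    where
    lemma : suc (4 * a) + 1 + 2 * (2 * (2 * k)) ≡ suc (1 + 4 * a) + 4 * (2 * k)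
    lemma = solve (a ∷ k ∷ [])
... | inj₂ (inj₁ (odd-2k , _)) = contradiction (trans (sym odd-2k) (odd-* 2 k)) λ ()
... | inj₂ (inj₂ (n≡6 , j , eq)) = inj₂ (inj₁ (n≡6 , inj₂ (finish a≡1 n≡6 sum)))
  where
  a<6 : a < 6
  a<6 = *-cancelˡ-< 4 a 6 (<-trans (n<1+n (4 * a)) (subst (λ n → 1 + 4 * a < 2 * (2 * n)) n≡6 g<4n))
  a≡1 : a ≡ 1
  a≡1 = 1+6k<6 j eq a<6
  finish : ∀ {a n} → a ≡ 1 → n ≡ 6 → 1 + 4 * a + h ≡ 2 * (2 * n) → h ≡ 19
  finish refl refl sum = +-cancelˡ-≡ 5 h 19 sum

-- For even n the reflection 2n - g is 1 mod 4, so `preserver-1mod4` applies to it: the residue 1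
-- returns g = 2n - 1, and 5 modulo 24 returns g = 7.
cases-3mod4 : ∀ {n h} a → 0 < n → 3 + 4 * a + h ≡ 2 * (2 * n) → 3 + 4 * a < 2 * (2 * n) →
  Preserves (2 * n) (3 + 4 * a) → Involution (4 * n) (3 + 4 * a) → Order2Cases n h
cases-3mod4 {n} {h} a 0<n sum g<4n pres inv with halve n
... | inj₂ (b , refl) = finish (preserver-3mod4 {1 + 2 * b} a (odd-1+2* b) g<4n pres inv) sum
  where
  finish : ∀ {n} → n ≡ 15 × (a ≡ 2 ⊎ a ≡ 4) → 3 + 4 * a + h ≡ 2 * (2 * n) → Order2Cases n h
  finish (refl , inj₁ refl) sum = inj₂ (inj₂ (refl , inj₂ (+-cancelˡ-≡ 11 h 49 sum)))
  finish (refl , inj₂ refl) sum = inj₂ (inj₂ (refl , inj₁ (+-cancelˡ-≡ 19 h 41 sum)))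
... | inj₁ (k , refl) = go (k ∸ suc a) (m+[n∸m]≡n a<k)
  where
  g<2n : 3 + 4 * a < 2 * (2 * k)
  g<2n = low⇒< {2 * (2 * k)} {3 + 4 * a} (preserves⇒low {2 * (2 * k)} {3 + 4 * a}
    (*-monoʳ-≤ 2 0<n) pres) g<4n
  a<k : a < k
  a<k = *-cancelˡ-< 4 a k (by-linear 3 g<2n lemma)
    where
    lemma : suc (4 * a) + 3 + 2 * (2 * k) ≡ suc (3 + 4 * a) + 4 * k
    lemma = solve (a ∷ k ∷ [])
  go : ∀ c → suc a + c ≡ k → Order2Cases (2 * k) h
  go c refl with preserver-1mod4 (2 * (suc a + c)) c 0<n
      (preserves-reflect {2 * (suc a + c)} {3 + 4 * a} {1 + 4 * c}
          (cong (λ b → not (not (not b))) (odd-* 4 a)) (lemma a) pres)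
    where
    lemma : ∀ a → 3 + 4 * a + (1 + 4 * c) ≡ 2 * (2 * (suc a + c))
    lemma a = solve (a ∷ c ∷ [])
  ... | inj₁ (j , eq) = inj₁ (finish c≡0 sum)
    where
    c<n : c < 2 * (suc a + c)
    c<n = ≤-trans (s≤s (m≤n+m c a)) (m≤m+n (suc a + c) _)
    c≡0 : c ≡ 0
    c≡0 = multiple-small j eq c<n
    finish : ∀ {c} → c ≡ 0 → 3 + 4 * a + h ≡ 2 * (2 * (2 * (suc a + c))) → h ≡ 1 + 2 * (2 * (suc a + c))
    finish refl sum = +-cancelˡ-≡ (3 + 4 * a) _ _ (trans sum (lemma (a + 0) (+-identityʳ a)))
      where
      lemma : ∀ x → x ≡ a → 2 * (2 * (2 * suc x)) ≡ 3 + 4 * a + (1 + 2 * (2 * suc x))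
      lemma _ refl = solve (a ∷ [])
  ... | inj₂ (inj₁ (odd-2k , _)) = contradiction (trans (sym odd-2k) (odd-* 2 (suc a + c))) λ ()
  ... | inj₂ (inj₂ (n≡6 , j , eq)) = inj₂ (inj₁ (n≡6 , inj₁ (finish a≡1 n≡6 sum)))
    where
    1+a+c≡3 : suc a + c ≡ 3
    1+a+c≡3 = *-cancelˡ-≡ (suc a + c) 3 2 n≡6
    c<6 : c < 6
    c<6 = ≤-trans (s≤s (m≤n+m c a)) (≤-trans (≤-reflexive 1+a+c≡3) (m≤m+n 3 3))
    a≡1 : a ≡ 1
    a≡1 = suc-injective (+-cancelʳ-≡ 1 (suc a) 2 (trans (cong (suc a +_) (sym (1+6k<6 j eq c<6))) 1+a+c≡3))
    finish : ∀ {a n} → a ≡ 1 → n ≡ 6 → 3 + 4 * a + h ≡ 2 * (2 * n) → h ≡ 17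
    finish refl refl sum = +-cancelˡ-≡ 7 h 17 sum

complement-involution : ∀ {d g h q} → g + h ≡ d → h * h ≡ 1 + q * d → Involution d g
complement-involution {g = g} {h} {q} refl hh = q + g , h , (begin
  g * g + h * (g + h)                   ≡⟨ lemma₁ ⟩
  h * h + g * (g + h)                   ≡⟨ cong (_+ g * (g + h)) hh ⟩
  1 + q * (g + h) + g * (g + h)         ≡⟨ lemma₂ ⟩
  1 + (q + g) * (g + h)                 ∎)
  where
  open ≡-Reasoning
  lemma₁ : g * g + h * (g + h) ≡ h * h + g * (g + h)
  lemma₁ = solve (g ∷ h ∷ [])
  lemma₂ : 1 + q * (g + h) + g * (g + h) ≡ 1 + (q + g) * (g + h)
  lemma₂ = solve (g ∷ h ∷ q ∷ [])

1mod2⇒1or3mod4 : ∀ g → odd g ≡ true → (∃ λ a → g ≡ 1 + 4 * a) ⊎ (∃ λ a → g ≡ 3 + 4 * a)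
1mod2⇒1or3mod4 g og with odd⇒1+2* g og
... | c , refl with halve c
...   | inj₁ (a , refl) = inj₁ (a , lemma)
  where
  lemma : 1 + 2 * (2 * a) ≡ 1 + 4 * a
  lemma = solve (a ∷ [])
...   | inj₂ (a , refl) = inj₂ (a , lemma)
  where
  lemma : 1 + 2 * (1 + 2 * a) ≡ 3 + 4 * a
  lemma = solve (a ∷ [])

cases-0mod4 : ∀ {n h} g → 0 < n → 1 < g → g < 2 * (2 * n) → g + h ≡ 2 * (2 * n) → odd g ≡ true →
  Preserves (2 * n) g → Involution (4 * n) g → Order2Cases n h
cases-0mod4 g 0<n 1<g g<4n sum og pres inv with 1mod2⇒1or3mod4 g og
... | inj₁ (a , refl) = cases-1mod4 a 0<n (λ { refl → n≮n 1 1<g }) sum g<4n pres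
... | inj₂ (a , refl) = cases-3mod4 a 0<n sum g<4n pres inv

flips⇒cases : ∀ {d h} → 2 < d → h < d → Coprime h d → (h * h) mod d ≡ 1 → Flips d h →
  h ≡ d ∸ 1 ⊎ (∃ λ n → d ≡ 2 * (2 * n) × Order2Cases n h)
flips⇒cases {d} {h} 2<d h<d h⊥d hh≡1 flips with h ≟ d ∸ 1
... | yes h≡d-1 = inj₁ h≡d-1
... | no h≢d-1 = inj₂ (by-parity d refl)
  where
  g = d ∸ h
  0<d : 0 < d
  0<d = <-trans z<s 2<d
  g+h≡d : g + h ≡ d
  g+h≡d = m∸n+n≡m (<⇒≤ h<d)
  1<g : 1 < g
  1<g = ≤∧≢⇒< (m<n⇒0<n∸m h<d) λ 1≡g → h≢d-1 (trans (sym (m∸[m∸n]≡n (<⇒≤ h<d))) (cong (d ∸_) (sym 1≡g)))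
  h≢0 : h ≢ 0
  h≢0 refl = contradiction (trans (sym (<⇒mod≡ {d} {0} 0<d)) hh≡1) λ ()
  g<d : g < d
  g<d = subst (g <_) g+h≡d (m<m+n g (n≢0⇒n>0 h≢0))
  same : ∀ u → Coprime u d → F d (2 * (g * u)) ≡ F d (2 * u)
  same = flips⇒complement-same {d} {h} {g} 2<d g+h≡d h⊥d flips
  -- Every 2^j is a unit, and the factor 2 inside `F d (2 * _)` raises it to the exponent j + 1.
  odd-case : odd d ≡ true → ⊥
  odd-case od = powers-of-two-separate {d} {g}
    (λ j → trans (cong (F d) (lemma (2 ^ j))) (same (2 ^ j) (coprime-2^ j od))) 1<g g<d
    where
    lemma : ∀ p → g * (2 * p) ≡ 2 * (g * p)
    lemma p = trans (sym (*-assoc g 2 p)) (trans (cong (_* p) (*-comm g 2)) (*-assoc 2 g p))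
  module Even {m} (d≡2m : d ≡ 2 * m) where
    0<m : 0 < m
    0<m = *-cancelˡ-< 2 0 m (subst (0 <_) d≡2m 0<d)
    preserves : Preserves m g
    preserves u u⊥2m = begin
      F m (g * u)                     ≡⟨ F-scale {m} 2 (g * u) 0<m z<s ⟨
      F (2 * m) (2 * (g * u))         ≡⟨ cong (λ x → F x (2 * (g * u))) d≡2m ⟨
      F d (2 * (g * u))               ≡⟨ same u (subst (Coprime u) (sym d≡2m) u⊥2m) ⟩
      F d (2 * u)                     ≡⟨ cong (λ x → F x (2 * u)) d≡2m ⟩
      F (2 * m) (2 * u)               ≡⟨ F-scale {m} 2 u 0<m z<s ⟩
      F m u                           ∎
      where open ≡-Reasoning
    odd-g : odd g ≡ true
    odd-g = xor-true (odd g) (odd h) (trans (sym (odd-+ g h)) (trans (cong odd (trans g+h≡d d≡2m)) (odd-* 2 m)))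
        (coprime-2*⇒odd {h} {m} (subst (Coprime h) d≡2m h⊥d))
      where
      xor-true : ∀ a b → a xor b ≡ false → b ≡ true → a ≡ true
      xor-true true _ _ _ = refl
      xor-true false true () _
      xor-true false false _ ()
  by-parity : ∀ x → d ≡ x → ∃ λ n → d ≡ 2 * (2 * n) × Order2Cases n h
  by-parity x d≡x with halve x
  ... | inj₂ (b , refl) = ⊥-elim (odd-case (trans (cong odd d≡x) (odd-1+2* b)))
  ... | inj₁ (m , refl) with halve m
  ...   | inj₂ (b , refl) = ⊥-elim
        (no-preserver-2mod4 {1 + 2 * b} {g} (odd-1+2* b) odd-g preserves 1<g (subst (g <_) d≡x g<d))
    where open Even {1 + 2 * b} d≡x
  ...   | inj₁ (n , refl) with mod-decompose {d} (h * h) 0<d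
  ...     | q , hh = n , d≡x , cases-0mod4 {n} {h} g (*-cancelˡ-< 2 0 n 0<m) 1<g (subst (g <_) d≡x g<d)
        (trans g+h≡d d≡x) odd-g preserves
            (complement-involution {4 * n} {g} {h} {q} (trans g+h≡d d≡4n)
              (trans hh (cong₂ _+_ hh≡1 (cong (q *_) d≡4n))))
    where
    open Even {2 * n} d≡x
    d≡4n : d ≡ 4 * n
    d≡4n = trans d≡x (sym (*-assoc 2 2 n))

-- The converse and the equivalence.

flips-[-1] : ∀ {d h} → 2 < d → h ≡ d ∸ 1 → Flips d h
flips-[-1] {d@(suc h)} 2<d refl u u⊥d = trans (F-reflect {d} (2 * u) (2 * (h * u)) (2 * u) d∤2u sum)
    (cong (λ b → not (b xor F d (2 * u))) (odd-* 2 u))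
  where
  d∤2u : ¬ (d ∣ 2 * u)
  d∤2u d∣ = <⇒≱ 2<d (∣⇒≤ (coprime-divisor (coprime-sym u⊥d) (subst (d ∣_) (*-comm 2 u) d∣)))
  sum : 2 * u + 2 * (h * u) ≡ 2 * u * suc h
  sum = solve (u ∷ h ∷ [])

-- Here 2hu = 2u + ud, and u is odd because it is prime to the even d.
flips-[1+d/2] : ∀ {d h} → 4 ∣ d → 0 < d → h ≡ d / 2 + 1 → Flips d h
flips-[1+d/2] {h = h} (divides n refl) 0<d h≡ u u⊥d = begin
  F d (2 * (h * u))                  ≡⟨ cong (F d) (trans (cong (λ x → 2 * (x * u)) h≡2n+1) (lemma n)) ⟩
  F d (2 * u + u * d)                ≡⟨ F-shift {d} (2 * u) u 0<d ⟩
  odd u xor F d (2 * u)              ≡⟨ cong (_xor F d (2 * u))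
      (coprime-2*⇒odd {u} {n * 2} (subst (Coprime u) (lemma′ n) u⊥d)) ⟩
  not (F d (2 * u))                  ∎
  where
  open ≡-Reasoning
  d = n * 4
  h≡2n+1 : h ≡ n * 2 + 1
  h≡2n+1 = trans h≡ (cong (_+ 1) (trans (cong (_/ 2) (sym (*-assoc n 2 2))) (m*n/n≡m (n * 2) 2)))
  lemma : ∀ n → 2 * ((n * 2 + 1) * u) ≡ 2 * u + u * (n * 4)
  lemma n = solve (n ∷ u ∷ [])
  lemma′ : ∀ n → n * 4 ≡ 2 * (n * 2)
  lemma′ n = solve (n ∷ [])

-- `FlipsBelow` is a check over finitely many residues, so the four sporadic pairs are settled by
-- evaluation.
flipsBelow? : ∀ d h → Dec (FlipsBelow d h)
flipsBelow? d h = allUpTo? (λ u → (isUnit d u ≟ᵇ true) →-dec ((2 * u <ᵇ d) ≟ᵇ not (2 * ((u * h) mod d) <ᵇ d))) d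

theorem3p2 : (d h : ℕ) → 2 < d → h < d → isUnit d h ≡ true → h ≢ 1 → (h * h) mod d ≡ 1 →
    (Balanced d h ⇔
    (h ≡ d ∸ 1
    ⊎ (4 ∣ d × h ≡ d / 2 + 1)
    ⊎ (d ≡ 24 × (h ≡ 17 ⊎ h ≡ 19))
    ⊎ (d ≡ 60 × (h ≡ 41 ⊎ h ≡ 49))))
theorem3p2 d h 2<d h<d unit-h h≢1 hh≡1 = mk⇔
  (λ bal → to (flips⇒cases 2<d h<d (isUnit⇒coprime {d} {h} unit-h) hh≡1
    (Equivalence.to below⇔flips (Equivalence.to balanced⇔below bal))))
  (λ cases → Equivalence.from balanced⇔below (from cases))
  where
  0<d : 0 < d
  0<d = <-trans z<s 2<d
  balanced⇔below = balanced⇔flipsBelow {d} {h} 2<d h<d unit-h h≢1 hh≡1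
  below⇔flips = flipsBelow⇔flips {d} {h} 0<d
  to : h ≡ d ∸ 1 ⊎ (∃ λ n → d ≡ 2 * (2 * n) × Order2Cases n h) →
    h ≡ d ∸ 1 ⊎ (4 ∣ d × h ≡ d / 2 + 1) ⊎ (d ≡ 24 × (h ≡ 17 ⊎ h ≡ 19)) ⊎ (d ≡ 60 × (h ≡ 41 ⊎ h ≡ 49))
  to (inj₁ e) = inj₁ e
  to (inj₂ (n , refl , inj₁ h≡)) = inj₂ (inj₁ (divides n (trans (sym (*-assoc 2 2 n)) (*-comm 4 n)) ,
    trans h≡ (trans (+-comm 1 (2 * n))
        (cong (_+ 1) (sym (trans (cong (_/ 2) (*-comm 2 (2 * n))) (m*n/n≡m (2 * n) 2)))))))
  to (inj₂ (n , d≡ , inj₂ (inj₁ (n≡6 , h≡)))) = inj₂ (inj₂ (inj₁ (trans d≡ (cong (λ n → 2 * (2 * n)) n≡6) , h≡)))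
  to (inj₂ (n , d≡ , inj₂ (inj₂ (n≡15 , h≡)))) = inj₂ (inj₂ (inj₂ (trans d≡ (cong (λ n → 2 * (2 * n)) n≡15) , h≡)))
  from : h ≡ d ∸ 1 ⊎ (4 ∣ d × h ≡ d / 2 + 1) ⊎ (d ≡ 24 × (h ≡ 17 ⊎ h ≡ 19)) ⊎ (d ≡ 60 × (h ≡ 41 ⊎ h ≡ 49)) →
      FlipsBelow d h
  from (inj₁ h≡d-1) = Equivalence.from below⇔flips (flips-[-1] 2<d h≡d-1)
  from (inj₂ (inj₁ (4∣d , h≡))) = Equivalence.from below⇔flips (flips-[1+d/2] 4∣d 0<d h≡)
  from (inj₂ (inj₂ (inj₁ (refl , inj₁ refl)))) = from-yes (flipsBelow? 24 17)
  from (inj₂ (inj₂ (inj₁ (refl , inj₂ refl)))) = from-yes (flipsBelow? 24 19)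
  from (inj₂ (inj₂ (inj₂ (refl , inj₁ refl)))) = from-yes (flipsBelow? 60 41)
  from (inj₂ (inj₂ (inj₂ (refl , inj₂ refl)))) = from-yes (flipsBelow? 60 49)
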